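{- Let $G=(V,E)$ be a locally finite graph, and let $x,y\in V$ with $d(x,y)=\delta\ge 2$ (with $\delta$ a finite integer). Then the function $p\mapsto \kappa_p(x,y)$ is concave and piecewise linear over $[0,1]$ with at most $3$ linear parts (that is, $[0,1]$ can be divided into at most three consecutive closed intervals on each of which the function is affine).
   Context: Graphs have no multiple edges and no self loops. $d_v$ denotes the degree of the vertex $v$, $w\sim v$ means that $w$ and $v$ are adjacent, and $d(v,w)$ is the combinatorial distance (length of a shortest path). For $v\in V$ and $p\in[0,1]$, $\mu_v^p$ is the probability measure on $V$ with $\mu_v^p(v)=p$, $\mu_v^p(z)=\frac{1-p}{d_v}$ if $z\sim v$, and $\mu_v^p(z)=0$ otherwise. For probability measures $\mu_1,\mu_2$ on $V$, the Wasserstein distance is $W_1(\mu_1,\mu_2)=\inf_{\pi}\sum_{v\in V}\sum_{w\in V} d(v,w)\pi(v,w)$, the infimum over all $\pi:V\times V\to[0,1]$ with $\mu_1(v)=\sum_{w}\pi(v,w)$ and $\mu_2(w)=\sum_{v}\pi(v,w)$. The $p$-Ollivier-Ricci curvature is $\kappa_p(x,y)=1-\frac{W_1(\mu_x^p,\mu_y^p)}{d(x,y)}$. -}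

module Defs where

open import Level using (0ℓ)
open import Algebra.Bundles using (CommutativeRing)
import Algebra.Definitions.RawMonoid as RawMonoidDefs
open import Axiom.ExcludedMiddle using (ExcludedMiddle)
open import Data.Fin.Base as Fin using (Fin; inject₁; fromℕ)
open import Data.List.Base using (List; length; map; foldr)
open import Data.List.Membership.Propositional using (_∈_)
open import Data.List.Relation.Unary.Unique.Propositional using (Unique)
open import Data.Nat.Base as ℕ using (ℕ; zero; suc)
open import Data.Product.Base using (Σ; ∃; ∃-syntax; _×_; _,_; proj₁; proj₂)
open import Function.Bundles using (_⇔_)
open import Relation.Binary.Core using (Rel)
open import Relation.Binary.Structures using (IsTotalOrder)
open import Relation.Binary.PropositionalEquality.Core using (_≡_)
open import Relation.Nullary.Construct.Add.Supremum using (_⁺; ⊤⁺; [_])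
open import Relation.Nullary.Decidable.Core using (yes; no)
open import Relation.Nullary.Negation.Core using (¬_)

module Bounds {A : Set} (_≤_ : Rel A 0ℓ) where

  IsLowerBound IsUpperBound IsInfimum IsSupremum : (A → Set) → A → Set
  IsLowerBound S b = ∀ c → S c → b ≤ c
  IsUpperBound S b = ∀ c → S c → c ≤ b
  IsInfimum    S b = IsLowerBound S b × (∀ a → IsLowerBound S a → a ≤ b)
  IsSupremum   S b = IsUpperBound S b × (∀ a → IsUpperBound S a → b ≤ a)

-- The library has no real numbers.  They are characterised, up to isomorphism,
-- as a complete ordered field; `inf S` and `x ⁻¹` are total operations whose
-- values are unspecified when S is empty or unbounded below, and when x is 0.
record CompleteOrderedField : Set₁ where
  infix  4 _≤_
  infix  8 _⁻¹
  field
    commutativeRing : CommutativeRing 0ℓ 0ℓ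
  open CommutativeRing commutativeRing public

  field
    _≤_          : Rel Carrier 0ℓ
    isTotalOrder : IsTotalOrder _≈_ _≤_
    +-monoˡ-≤    : ∀ z {x y} → x ≤ y → x + z ≤ y + z
    *-nonNeg     : ∀ {x y} → 0# ≤ x → 0# ≤ y → 0# ≤ x * y
    0≉1          : ¬ 0# ≈ 1#
    _⁻¹          : Carrier → Carrier
    ⁻¹-inverseʳ  : ∀ {x} → ¬ x ≈ 0# → x * x ⁻¹ ≈ 1#

  open Bounds _≤_ public

  field
    inf           : (Carrier → Set) → Carrier
    inf-isInfimum : ∀ S → ∃ S → ∃ (IsLowerBound S) → IsInfimum S (inf S)

  open RawMonoidDefs +-rawMonoid using () renaming (_×_ to _·_)

  fromNat : ℕ → Carrier
  fromNat n = n · 1#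

  _∈[_,_] : Carrier → Carrier → Carrier → Set
  p ∈[ a , b ] = a ≤ p × p ≤ b

  -- The sum of a nonnegative family over a possibly infinite index type, as
  -- the supremum of its finite partial sums.
  HasSum : {I : Set} → (I → Carrier) → Carrier → Set
  HasSum {I} f = IsSupremum λ s →
    ∃[ l ] Unique {A = I} l × s ≈ foldr _+_ 0# (map f l)

  ConcaveOn[0,1] : (Carrier → Carrier) → Set
  ConcaveOn[0,1] f = ∀ p q t →
    p ∈[ 0# , 1# ] → q ∈[ 0# , 1# ] → t ∈[ 0# , 1# ] →
    t * f p + (1# - t) * f q ≤ f (t * p + (1# - t) * q)

  AffineOn : Carrier → Carrier → (Carrier → Carrier) → Set
  AffineOn a b f = ∃[ m ] ∃[ c ] (∀ p → p ∈[ a , b ] → f p ≈ m * p + c)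

  -- Consecutive breakpoints may coincide, so n is an upper bound on the number
  -- of linear parts.  The intervals are closed and share their endpoints, which
  -- forces continuity on [0,1].
  PiecewiseLinearOn[0,1] : ℕ → (Carrier → Carrier) → Set
  PiecewiseLinearOn[0,1] n f = Σ (Fin (suc n) → Carrier) λ t →
    t Fin.zero ≈ 0# × t (fromℕ n) ≈ 1# ×
    (∀ (i : Fin n) → t (inject₁ i) ≤ t (Fin.suc i)
                   × AffineOn (t (inject₁ i)) (t (Fin.suc i)) f)

-- Neither connectedness nor finiteness of the vertex set is assumed.
record LocallyFiniteGraph : Set₁ where
  infix 4 _~_
  field
    V             : Set
    _~_           : V → V → Set
    ~-sym         : ∀ {v w} → v ~ w → w ~ v
    ~-irrefl      : ∀ {v} → ¬ v ~ v
    locallyFinite : ∀ v → ∃[ l ] Unique l × (∀ w → w ∈ l ⇔ v ~ w)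

  degree : V → ℕ
  degree v = length (proj₁ (locallyFinite v))

  data Path : V → V → ℕ → Set where
    nil  : ∀ {v} → Path v v zero
    cons : ∀ {u v w n} → u ~ v → Path v w n → Path u w (suc n)

  IsDistance : V → V → ℕ → Set
  IsDistance v w n = Path v w n × (∀ m → Path v w m → n ℕ.≤ m)

module Curvature (em : ExcludedMiddle 0ℓ)
                 (R : CompleteOrderedField)
                 (G : LocallyFiniteGraph) where

  open CompleteOrderedField R public
  open LocallyFiniteGraph G public

  -- ⊤⁺ plays the role of ∞, the distance between different components.
  dist : V → V → ℕ ⁺
  dist v w with em {∃ (IsDistance v w)}
  ... | yes (n , _) = [ n ]
  ... | no _        = ⊤⁺

  μ : V → Carrier → V → Carrier
  μ v p z with em {z ≡ v} | em {z ~ v}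
  ... | yes _ | _     = p
  ... | no _  | yes _ = (1# - p) * fromNat (degree v) ⁻¹
  ... | no _  | no _  = 0#

  IsCoupling : (μ₁ μ₂ : V → Carrier) → (V → V → Carrier) → Set
  IsCoupling μ₁ μ₂ π =
    (∀ v w → π v w ∈[ 0# , 1# ]) ×
    (∀ v → HasSum (λ w → π v w) (μ₁ v)) ×
    (∀ w → HasSum (λ v → π v w) (μ₂ w))

  -- IsProduct d m c says that d · m, computed in [0,∞] with ∞ · 0 = 0, is the
  -- real number c.
  IsProduct : ℕ ⁺ → Carrier → Carrier → Set
  IsProduct [ n ] m c = c ≈ fromNat n * m
  IsProduct ⊤⁺    m c = m ≈ 0# × c ≈ 0#

  -- c is the finite value of the double sum Σ_v Σ_w d(v,w) π(v,w).
  HasCost : (V → V → Carrier) → Carrier → Set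
  HasCost π c = Σ (V → V → Carrier) λ term → Σ (V → Carrier) λ row →
    (∀ v w → IsProduct (dist v w) (π v w) (term v w)) ×
    (∀ v → HasSum (λ w → term v w) (row v)) ×
    HasSum row c

  -- Couplings of infinite cost do not affect the infimum as soon as some
  -- coupling has finite cost.
  W₁ : (μ₁ μ₂ : V → Carrier) → Carrier
  W₁ μ₁ μ₂ = inf λ c → ∃[ π ] IsCoupling μ₁ μ₂ π × HasCost π c

  -- Only meaningful at finite positive distance; the value in the case ⊤⁺ is a
  -- placeholder.
  κ : Carrier → V → V → Carrier
  κ p x y with dist x y
  ... | [ d ] = 1# - W₁ (μ x p) (μ y p) * fromNat d ⁻¹
  ... | ⊤⁺    = 0#

{-# OPTIONS --safe #-}

module Submission where

import Algebra.Solver.Ring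
open import Algebra.Solver.Ring.AlmostCommutativeRing using (_-Raw-AlmostCommutative⟶_; fromCommutativeRing)
open import Axiom.ExcludedMiddle using (ExcludedMiddle)
open import Data.Empty using (⊥-elim)
open import Data.Fin.Base as Fin using (Fin)
open import Data.Integer.Base as ℤ using (ℤ; -[1+_]; 0ℤ; 1ℤ; -1ℤ; +≤+; _⊖_)
import Data.Integer.DivMod as ℤ
import Data.Integer.Properties as ℤₚ
open import Data.Integer.Tactic.RingSolver using (solve-∀)
open import Data.List.Base using (List; []; _∷_; _++_; map; foldr; length; cartesianProductWith)
open import Data.List.Membership.Propositional using (_∈_; _∉_)
open import Data.List.Membership.Propositional.Properties using (∈-cartesianProductWith⁺; ∈-cartesianProductWith⁻)
open import Data.List.Relation.Unary.All as All using ([]; _∷_)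
open import Data.List.Relation.Unary.AllPairs using ([]; _∷_)
open import Data.List.Relation.Unary.Any using (here; there)
open import Data.List.Relation.Unary.Unique.Propositional using (Unique)
open import Data.Maybe.Base using (Maybe; just; nothing)
open import Data.Nat.Base as ℕ using (ℕ; zero; suc; z≤n; s≤s)
open import Data.Nat.Induction using (<-rec)
import Data.Nat.Properties as ℕₚ
open import Data.Product.Base using (∃; ∃-syntax; _×_; _,_; proj₁; proj₂)
open import Data.Sum.Base using (_⊎_; inj₁; inj₂)
open import Data.Sum.Properties using (inj₁-injective; inj₂-injective)
open import Function.Base using (id; _∘_)
open import Function.Bundles using (module Equivalence)
open import Level using (0ℓ)
open import Relation.Binary.PropositionalEquality.Core as ≡ using (_≡_; _≢_)
open import Relation.Nullary.Construct.Add.Supremum using ([_]; ⊤⁺)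
open import Relation.Nullary.Decidable.Core using (yes; no)
open import Relation.Nullary.Negation.Core using (¬_)
open import Defs

-- Kantorovich duality holds with integer potentials: W₁(μ_x^p, μ_y^p) is the
-- supremum, over integer u and v with u(a) − v(b) ≤ d(a,b) for a in the unit ball
-- of x and b in that of y, of p (u(x) − v(y)) + (1 − p) g, where g is the average
-- of u over the neighbours of x minus that of v over the neighbours of y.  The
-- difference u(x) − v(y) is an integer at most δ.  By the triangle inequality the
-- values at the neighbours always admit new values at x and y with difference
-- δ − 2, so smaller differences are never needed, and W₁ is the maximum of three
-- affine functions of p, one for each of δ, δ − 1 and δ − 2.
--
-- The duality is proved by Fourier–Motzkin elimination: the edges of the transport
-- network are removed one at a time, the weight of each being chosen between the
-- lower and upper bounds that the remaining potentials put on it.  The bounds are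
-- compatible since a positive integer combination of integer potentials splits,
-- by taking quotients, into integer potentials again.

-- Arithmetic, order and suprema in a complete ordered field.

module OrderedField (R : CompleteOrderedField) where

  open CompleteOrderedField R
  open import Algebra.Properties.Ring ring public using (-‿involutive; -0#≈0#; -‿distribˡ-*)
  open import Algebra.Properties.AbelianGroup +-abelianGroup using (⁻¹-∙-comm)
  open import Algebra.Properties.Semiring.Mult semiring using (×-homo-+; ×1-homo-*)
  open import Relation.Binary.Reasoning.Setoid setoid

  -- Potentials are integers while measures are real. `ι` and its homomorphism laws connect the two,
  -- and also provide the coefficients of the ring solver.
  ι : ℤ → Carrier
  ι (ℤ.+ n)   = fromNat n
  ι -[1+ n ]  = - fromNat (suc n)

  private
    1+x-1+y : ∀ x y → (1# + x) - (1# + y) ≈ x - y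
    1+x-1+y x y = begin
      (1# + x) + - (1# + y)      ≈⟨ +-cong (+-comm 1# x) (sym (⁻¹-∙-comm 1# y)) ⟩
      (x + 1#) + (- 1# + - y)    ≈⟨ +-assoc x 1# _ ⟩
      x + (1# + (- 1# + - y))    ≈⟨ +-congˡ (sym (+-assoc 1# (- 1#) (- y))) ⟩
      x + ((1# + - 1#) + - y)    ≈⟨ +-congˡ (+-congʳ (-‿inverseʳ 1#)) ⟩
      x + (0# + - y)             ≈⟨ +-congˡ (+-identityˡ (- y)) ⟩
      x + - y                    ∎

  ι-⊖ : ∀ m n → ι (m ⊖ n) ≈ fromNat m - fromNat n
  ι-⊖ zero    zero    = sym (-‿inverseʳ 0#)
  ι-⊖ zero    (suc n) = sym (+-identityˡ _)
  ι-⊖ (suc m) zero    = sym (trans (+-congˡ -0#≈0#) (+-identityʳ _))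
  ι-⊖ (suc m) (suc n) = begin
    ι (suc m ⊖ suc n)               ≡⟨ ≡.cong ι (ℤₚ.[1+m]⊖[1+n]≡m⊖n m n) ⟩
    ι (m ⊖ n)                       ≈⟨ ι-⊖ m n ⟩
    fromNat m - fromNat n           ≈⟨ 1+x-1+y _ _ ⟨
    fromNat (suc m) - fromNat (suc n) ∎

  ι-+ : ∀ i j → ι (i ℤ.+ j) ≈ ι i + ι j
  ι-+ (ℤ.+ m)   (ℤ.+ n)   = ×-homo-+ 1# m n
  ι-+ (ℤ.+ m)   -[1+ n ]  = ι-⊖ m (suc n)
  ι-+ -[1+ m ]  (ℤ.+ n)   = trans (ι-⊖ n (suc m)) (+-comm _ _)
  ι-+ -[1+ m ]  -[1+ n ]  = begin
    - (1# + (1# + fromNat (m ℕ.+ n)))      ≈⟨ -‿cong (+-congˡ (+-congˡ (×-homo-+ 1# m n))) ⟩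
    - (1# + (1# + (fromNat m + fromNat n)))  ≈⟨ -‿cong (+-congˡ (sym (+-assoc _ _ _))) ⟩
    - (1# + ((1# + fromNat m) + fromNat n))  ≈⟨ -‿cong (+-congˡ (+-comm _ _)) ⟩
    - (1# + (fromNat n + fromNat (suc m)))   ≈⟨ -‿cong (sym (+-assoc _ _ _)) ⟩
    - (fromNat (suc n) + fromNat (suc m))    ≈⟨ -‿cong (+-comm _ _) ⟩
    - (fromNat (suc m) + fromNat (suc n))    ≈⟨ ⁻¹-∙-comm _ _ ⟨
    - fromNat (suc m) - fromNat (suc n)      ∎

  ι-neg : ∀ i → ι (ℤ.- i) ≈ - ι i
  ι-neg (ℤ.+ zero)  = sym -0#≈0#
  ι-neg (ℤ.+ suc n) = refl
  ι-neg -[1+ n ]    = sym (-‿involutive _)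

  ι-- : ∀ i j → ι (i ℤ.- j) ≈ ι i - ι j
  ι-- i j = trans (ι-+ i (ℤ.- j)) (+-congˡ (ι-neg j))

  private
    ι-*⁺ : ∀ n j → ι (ℤ.+ n ℤ.* j) ≈ fromNat n * ι j
    ι-*⁺ zero    j = sym (zeroˡ (ι j))
    ι-*⁺ (suc n) j = begin
      ι (ℤ.+ suc n ℤ.* j)       ≡⟨ ≡.cong ι (ℤₚ.suc-* (ℤ.+ n) j) ⟩
      ι (j ℤ.+ ℤ.+ n ℤ.* j)       ≈⟨ ι-+ j (ℤ.+ n ℤ.* j) ⟩
      ι j + ι (ℤ.+ n ℤ.* j)       ≈⟨ +-cong (sym (*-identityˡ _)) (ι-*⁺ n j) ⟩
      1# * ι j + fromNat n * ι j  ≈⟨ distribʳ _ _ _ ⟨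
      fromNat (suc n) * ι j       ∎

  ι-* : ∀ i j → ι (i ℤ.* j) ≈ ι i * ι j
  ι-* (ℤ.+ n)  j = ι-*⁺ n j
  ι-* -[1+ n ] j = begin
    ι (-[1+ n ] ℤ.* j)            ≡⟨ ≡.cong ι (≡.sym (ℤₚ.neg-distribˡ-* (ℤ.+ suc n) j)) ⟩
    ι (ℤ.- (ℤ.+ suc n ℤ.* j))     ≈⟨ ι-neg (ℤ.+ suc n ℤ.* j) ⟩
    - ι (ℤ.+ suc n ℤ.* j)         ≈⟨ -‿cong (ι-*⁺ (suc n) j) ⟩
    - (fromNat (suc n) * ι j)     ≈⟨ -‿distribˡ-* _ _ ⟩
    - fromNat (suc n) * ι j       ∎

  private
    -- Agrees with ι, except that the solver's literal 1 must denote 1# itself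
    -- and not 1# + 0#.
    coefficient : ℤ → Carrier
    coefficient (ℤ.+ 1) = 1#
    coefficient i       = ι i

    coefficient≈ι : ∀ i → coefficient i ≈ ι i
    coefficient≈ι (ℤ.+ zero)        = refl
    coefficient≈ι (ℤ.+ 1)           = sym (+-identityʳ 1#)
    coefficient≈ι (ℤ.+ suc (suc n)) = refl
    coefficient≈ι -[1+ n ]          = refl

    morphism : ℤ.+-*-rawRing -Raw-AlmostCommutative⟶ fromCommutativeRing commutativeRing
    morphism = record
      { ⟦_⟧    = coefficient
      ; +-homo = λ i j → trans (coefficient≈ι (i ℤ.+ j)) (trans (ι-+ i j) (sym (+-cong (coefficient≈ι i) (coefficient≈ι j))))
      ; *-homo = λ i j → trans (coefficient≈ι (i ℤ.* j)) (trans (ι-* i j) (sym (*-cong (coefficient≈ι i) (coefficient≈ι j))))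
      ; -‿homo = λ i → trans (coefficient≈ι (ℤ.- i)) (trans (ι-neg i) (sym (-‿cong (coefficient≈ι i))))
      ; 0-homo = refl
      ; 1-homo = refl
      }

    coefficient≟ : ∀ i j → Maybe (coefficient i ≈ coefficient j)
    coefficient≟ i j with i ℤₚ.≟ j
    ... | yes ≡.refl = just refl
    ... | no _       = nothing

  open Algebra.Solver.Ring ℤ.+-*-rawRing (fromCommutativeRing commutativeRing) morphism coefficient≟ public
    using (solve; _:=_; _:+_; _:*_; :-_; _:-_; con)

  open import Relation.Binary.Structures using (IsTotalOrder)
  open IsTotalOrder isTotalOrder public
    using (total; ≤-respˡ-≈; ≤-respʳ-≈)
    renaming (refl to ≤-refl; reflexive to ≤-reflexive; trans to ≤-trans; antisym to ≤-antisym)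

  ≤⇒0≤- : ∀ {x y} → x ≤ y → 0# ≤ y - x
  ≤⇒0≤- {x} x≤y = ≤-respˡ-≈ (-‿inverseʳ x) (+-monoˡ-≤ (- x) x≤y)

  -- The workhorse for linear inequalities: e is a nonnegative combination of
  -- hypotheses, and the equation is left to the ring solver.
  ≤-by : ∀ {x y e} → 0# ≤ e → y - x ≈ e → x ≤ y
  ≤-by {x} {y} {e} 0≤e eq = ≤-respˡ-≈ (+-identityˡ x) (≤-respʳ-≈ eq′ (+-monoˡ-≤ x 0≤e))
    where
    eq′ : e + x ≈ y
    eq′ = trans (+-congʳ (sym eq)) (solve 2 (λ x y → (y :- x) :+ x := y) refl x y)

  0≤+ : ∀ {x y} → 0# ≤ x → 0# ≤ y → 0# ≤ x + y
  0≤+ {x} {y} 0≤x 0≤y = ≤-trans 0≤y (≤-respˡ-≈ (+-identityˡ y) (+-monoˡ-≤ y 0≤x))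

  +-mono-≤ : ∀ {x y u v} → x ≤ y → u ≤ v → x + u ≤ y + v
  +-mono-≤ {x} {y} {u} {v} x≤y u≤v = ≤-by (0≤+ (≤⇒0≤- x≤y) (≤⇒0≤- u≤v))
    (solve 4 (λ x y u v → (y :+ v) :- (x :+ u) := (y :- x) :+ (v :- u)) refl x y u v)

  neg-mono-≤ : ∀ {x y} → x ≤ y → - y ≤ - x
  neg-mono-≤ {x} {y} x≤y = ≤-by (≤⇒0≤- x≤y) (solve 2 (λ x y → (:- x) :- (:- y) := y :- x) refl x y)

  *-monoˡ-≤ : ∀ {x y z} → 0# ≤ z → x ≤ y → z * x ≤ z * y
  *-monoˡ-≤ {x} {y} {z} 0≤z x≤y = ≤-by (*-nonNeg 0≤z (≤⇒0≤- x≤y))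
    (solve 3 (λ x y z → z :* y :- z :* x := z :* (y :- x)) refl x y z)

  *-monoʳ-≤ : ∀ {x y z} → 0# ≤ z → x ≤ y → x * z ≤ y * z
  *-monoʳ-≤ {x} {y} {z} 0≤z x≤y = ≤-by (*-nonNeg 0≤z (≤⇒0≤- x≤y))
    (solve 3 (λ x y z → y :* z :- x :* z := z :* (y :- x)) refl x y z)

  0≤1 : 0# ≤ 1#
  0≤1 with total 0# 1#
  ... | inj₁ 0≤1 = 0≤1
  ... | inj₂ 1≤0 = ≤-respʳ-≈ (solve 0 (:- con (ℤ.+ 1) :* :- con (ℤ.+ 1) := con (ℤ.+ 1)) refl) (*-nonNeg 0≤-1 0≤-1)
    where
    0≤-1 : 0# ≤ - 1#
    0≤-1 = ≤-respˡ-≈ -0#≈0# (neg-mono-≤ 1≤0)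

  0≤fromNat : ∀ n → 0# ≤ fromNat n
  0≤fromNat zero    = ≤-refl
  0≤fromNat (suc n) = 0≤+ 0≤1 (0≤fromNat n)

  1≤fromNat-suc : ∀ n → 1# ≤ fromNat (suc n)
  1≤fromNat-suc n = ≤-by (0≤fromNat n) (solve 2 (λ one x → (one :+ x) :- one := x) refl 1# (fromNat n))

  fromNat-suc≉0 : ∀ n → ¬ fromNat (suc n) ≈ 0#
  fromNat-suc≉0 n eq = 0≉1 (≤-antisym 0≤1 (≤-respʳ-≈ eq (1≤fromNat-suc n)))

  ι-mono-≤ : ∀ {i j} → i ℤ.≤ j → ι i ≤ ι j
  ι-mono-≤ {i} {j} i≤j with ℤ.∣ j ℤ.- i ∣ | ℤₚ.0≤i⇒+∣i∣≡i (ℤₚ.i≤j⇒0≤j-i i≤j)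
  ... | n | eq = ≤-by (0≤fromNat n) (trans (sym (ι-- j i)) (reflexive (≡.sym (≡.cong ι eq))))

  0≤⁻¹ : ∀ {x} → 0# ≤ x → ¬ x ≈ 0# → 0# ≤ x ⁻¹
  0≤⁻¹ {x} 0≤x x≉0 with total 0# (x ⁻¹)
  ... | inj₁ h = h
  ... | inj₂ h = ⊥-elim (0≉1 (≤-antisym 0≤1 (≤-respˡ-≈ (⁻¹-inverseʳ x≉0) (≤-respʳ-≈ (zeroʳ x) (*-monoˡ-≤ 0≤x h)))))

  *-cancelˡ-≤ : ∀ {x y z} → 0# ≤ z → ¬ z ≈ 0# → z * x ≤ z * y → x ≤ y
  *-cancelˡ-≤ {x} {y} {z} 0≤z z≉0 h = ≤-respˡ-≈ (cancel x) (≤-respʳ-≈ (cancel y) (*-monoˡ-≤ (0≤⁻¹ 0≤z z≉0) h))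
    where
    cancel : ∀ w → z ⁻¹ * (z * w) ≈ w
    cancel w = begin
      z ⁻¹ * (z * w)  ≈⟨ solve 3 (λ i z w → i :* (z :* w) := (z :* i) :* w) refl (z ⁻¹) z w ⟩
      (z * z ⁻¹) * w  ≈⟨ *-congʳ (⁻¹-inverseʳ z≉0) ⟩
      1# * w          ≈⟨ *-identityˡ w ⟩
      w               ∎

  divide : ∀ {z} → ¬ z ≈ 0# → ∀ x → (x * z ⁻¹) * z ≈ x
  divide {z} z≉0 x = begin
    (x * z ⁻¹) * z  ≈⟨ solve 3 (λ i z x → (x :* i) :* z := (z :* i) :* x) refl (z ⁻¹) z x ⟩
    (z * z ⁻¹) * x  ≈⟨ *-congʳ (⁻¹-inverseʳ z≉0) ⟩
    1# * x          ≈⟨ *-identityˡ x ⟩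
    x               ∎

  -- Let `m` be the infimum of the values -n x. Since -(n + 1) x is again such a value, m + x is a
  -- lower bound too, so m + x ≤ m.
  archimedean : ∀ {x M} → (∀ n → fromNat n * x ≤ M) → x ≤ 0#
  archimedean {x} {M} bounded = ≤-by (≤⇒0≤- (greatest (m + x) λ _ (n , eq) → ≤-respʳ-≈ (sym eq) (below n)))
      (solve 2 (λ x m → con (ℤ.+ 0) :- x := m :- (m :+ x)) refl x m)
    where
    S : Carrier → Set
    S s = ∃[ n ] s ≈ - (fromNat n * x)
    isInf : IsInfimum S (inf S)
    isInf = inf-isInfimum S (_ , 0 , refl) (- M , λ _ (n , eq) → ≤-respʳ-≈ (sym eq) (neg-mono-≤ (bounded n)))
    m : Carrier
    m = inf S
    greatest : ∀ a → IsLowerBound S a → a ≤ m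
    greatest = proj₂ isInf
    below : ∀ n → m + x ≤ - (fromNat n * x)
    below n = ≤-by (≤⇒0≤- (proj₁ isInf _ (suc n , refl)))
      (solve 3 (λ x m k → (:- (k :* x)) :- (m :+ x) := (:- ((con (ℤ.+ 1) :+ k) :* x)) :- m) refl x m (fromNat n))

  supremum : (S : Carrier → Set) → ∃ S → ∃ (IsUpperBound S) → ∃ (IsSupremum S)
  supremum S (s , Ss) (b , S≤b) = - inf S⁻ ,
      (λ c Sc → ≤-respˡ-≈ (-‿involutive c) (neg-mono-≤ (proj₁ isInf (- c) (c , Sc , refl)))) ,
      (λ a S≤a → ≤-respʳ-≈ (-‿involutive a) (neg-mono-≤ (proj₂ isInf (- a)
        λ _ (c , Sc , eq) → ≤-respʳ-≈ (sym eq) (neg-mono-≤ (S≤a c Sc)))))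
    where
    S⁻ : Carrier → Set
    S⁻ r = ∃[ c ] S c × r ≈ - c
    isInf : IsInfimum S⁻ (inf S⁻)
    isInf = inf-isInfimum S⁻ (- s , s , Ss , refl) (- b , λ _ (c , Sc , eq) → ≤-respʳ-≈ (sym eq) (neg-mono-≤ (S≤b c Sc)))

  *-supremum-≤ : ∀ {S z s a} → 0# ≤ z → ¬ z ≈ 0# → IsSupremum S s → (∀ c → S c → z * c ≤ a) → z * s ≤ a
  *-supremum-≤ {z = z} {s} {a} 0≤z z≉0 (_ , least) bound =
    ≤-respʳ-≈ z*[a/z]≈a (*-monoˡ-≤ 0≤z (least (a * z ⁻¹) λ c Sc → *-cancelˡ-≤ 0≤z z≉0 (≤-respʳ-≈ (sym z*[a/z]≈a) (bound c Sc))))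
    where
    z*[a/z]≈a : z * (a * z ⁻¹) ≈ a
    z*[a/z]≈a = trans (*-comm _ _) (divide z≉0 a)

  maximum₃ : ∀ x y z → ∃[ m ] x ≤ m × y ≤ m × z ≤ m
  maximum₃ x y z with total x y
  ... | inj₁ x≤y with total y z
  ...   | inj₁ y≤z = z , ≤-trans x≤y y≤z , y≤z , ≤-refl
  ...   | inj₂ z≤y = y , x≤y , ≤-refl , z≤y
  maximum₃ x y z | inj₂ y≤x with total x z
  ...   | inj₁ x≤z = z , x≤z , ≤-trans y≤x x≤z , ≤-refl
  ...   | inj₂ z≤x = x , ≤-refl , y≤x , z≤x

  -- Both inequalities compare p (g + h) with h, so the crossing point is h / (g + h). In the
  -- application g is the increase of the potential difference from one line to another and h the
  -- accompanying loss of gain.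
  single-crossing : ∀ g h → 0# ≤ g → ¬ g ≈ 0# → 0# ≤ h → ∃[ c ] c ∈[ 0# , 1# ] ×
    (∀ p → p ≤ c → p * g ≤ (1# - p) * h) × (∀ p → c ≤ p → (1# - p) * h ≤ p * g)
  single-crossing g h 0≤g g≉0 0≤h =
      c , (*-nonNeg 0≤h (0≤⁻¹ 0≤g+h g+h≉0) ,
           *-cancelˡ-≤ 0≤g+h g+h≉0 (≤-by 0≤g (trans (+-congˡ (-‿cong (trans (*-comm _ _) c[g+h]≈h)))
             (solve 2 (λ g h → (g :+ h) :* con (ℤ.+ 1) :- h := g) refl g h)))) ,
      (λ p p≤c → ≤-by (≤⇒0≤- (≤-respʳ-≈ c[g+h]≈h (*-monoʳ-≤ 0≤g+h p≤c)))
        (solve 3 (λ p g h → (con (ℤ.+ 1) :- p) :* h :- p :* g := h :- p :* (g :+ h)) refl p g h)) ,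
      (λ p c≤p → ≤-by (≤⇒0≤- (≤-respˡ-≈ c[g+h]≈h (*-monoʳ-≤ 0≤g+h c≤p)))
        (solve 3 (λ p g h → p :* g :- (con (ℤ.+ 1) :- p) :* h := p :* (g :+ h) :- h) refl p g h))
    where
    0≤g+h : 0# ≤ g + h
    0≤g+h = 0≤+ 0≤g 0≤h
    g+h≉0 : ¬ g + h ≈ 0#
    g+h≉0 eq = g≉0 (≤-antisym (≤-respʳ-≈ eq (≤-by 0≤h (solve 2 (λ g h → (g :+ h) :- g := h) refl g h))) 0≤g)
    c : Carrier
    c = h * (g + h) ⁻¹
    c[g+h]≈h : c * (g + h) ≈ h
    c[g+h]≈h = divide g+h≉0 h

-- Integer inequalities and division with remainder.

≤-byℤ : ∀ {i j e} → 0ℤ ℤ.≤ e → j ℤ.- i ≡ e → i ℤ.≤ j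
≤-byℤ 0≤e ≡.refl = ℤₚ.0≤i-j⇒j≤i 0≤e

0≤+ℤ : ∀ {i j} → 0ℤ ℤ.≤ i → 0ℤ ℤ.≤ j → 0ℤ ℤ.≤ i ℤ.+ j
0≤+ℤ = ℤₚ.+-mono-≤

0≤+*ℤ : ∀ n {i} → 0ℤ ℤ.≤ i → 0ℤ ℤ.≤ ℤ.+ n ℤ.* i
0≤+*ℤ n {i} 0≤i = ℤₚ.≤-trans (ℤₚ.≤-reflexive (≡.sym (ℤₚ.*-zeroʳ (ℤ.+ n)))) (ℤₚ.*-monoˡ-≤-nonNeg (ℤ.+ n) 0≤i)

private
  -- If d = 0 the bound is the hypothesis; if d ≥ 1 then r ≤ m ≤ m d; and d ≤ -1 is impossible, as
  -- the right-hand side of the hypothesis would be at most s - (m + 1) < 0 ≤ r.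
  remainder-bound : ∀ m r s d → r ℕ.≤ m → s ℕ.≤ m → ℤ.+ r ℤ.≤ ℤ.+ s ℤ.+ ℤ.+ suc m ℤ.* d →
                    0ℤ ℤ.≤ d × ℤ.+ r ℤ.≤ ℤ.+ s ℤ.+ ℤ.+ m ℤ.* d
  remainder-bound m r s (ℤ.+ zero) _ _ h = +≤+ z≤n ,
    ℤₚ.≤-trans h (ℤₚ.≤-reflexive (≡.cong (λ x → ℤ.+ s ℤ.+ x) (≡.trans (ℤₚ.*-zeroʳ (ℤ.+ suc m)) (≡.sym (ℤₚ.*-zeroʳ (ℤ.+ m))))))
  remainder-bound m r s (ℤ.+ suc k) r≤m _ _ = +≤+ z≤n , (begin
    ℤ.+ r                          ≤⟨ +≤+ (ℕₚ.≤-trans r≤m (ℕₚ.≤-trans (ℕₚ.m≤m*n m (suc k)) (ℕₚ.m≤n+m _ s))) ⟩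
    ℤ.+ (s ℕ.+ m ℕ.* suc k)        ≡⟨ ℤₚ.pos-+ s (m ℕ.* suc k) ⟩
    ℤ.+ s ℤ.+ ℤ.+ (m ℕ.* suc k)    ≡⟨ ≡.cong (λ x → ℤ.+ s ℤ.+ x) (ℤₚ.pos-* m (suc k)) ⟩
    ℤ.+ s ℤ.+ ℤ.+ m ℤ.* ℤ.+ suc k  ∎)
    where open ℤₚ.≤-Reasoning
  remainder-bound m r s -[1+ k ] _ s≤m h = ⊥-elim (absurd (ℤₚ.≤-trans h negative))
    where
    negative : ℤ.+ s ℤ.+ ℤ.+ suc m ℤ.* -[1+ k ] ℤ.≤ -[1+ 0 ]
    negative = ≤-byℤ (0≤+ℤ (ℤₚ.i≤j⇒0≤j-i (+≤+ s≤m)) (0≤+*ℤ (suc m) {ℤ.+ k} (+≤+ z≤n)))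
                     (identity (ℤ.+ s) (ℤ.+ m) (ℤ.+ k))
      where
      identity : ∀ s m k → ℤ.- 1ℤ ℤ.- (s ℤ.+ (1ℤ ℤ.+ m) ℤ.* (ℤ.- (1ℤ ℤ.+ k))) ≡ (m ℤ.- s) ℤ.+ (1ℤ ℤ.+ m) ℤ.* k
      identity = solve-∀
    absurd : ¬ ℤ.+ r ℤ.≤ -[1+ 0 ]
    absurd ()

-- With n = m + 1, a = r + q n and b = s + q′ n, the hypothesis reads r ≤ s + n d for d = q′ + c -
-- q, and the two claims read d ≥ 0 and r ≤ s + m d. Thus an n-fold constraint splits into a single
-- one for the quotients and an m-fold one for the rest.
quotient-bound : ∀ m a b c → a ℤ.≤ b ℤ.+ ℤ.+ suc m ℤ.* c →
  let n = suc m in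
  a ℤ./ℕ n ℤ.≤ b ℤ./ℕ n ℤ.+ c ×
  a ℤ.- a ℤ./ℕ n ℤ.≤ (b ℤ.- b ℤ./ℕ n) ℤ.+ ℤ.+ m ℤ.* c
quotient-bound m a b c h =
  ≤-byℤ (proj₁ bounds) (≡.refl) ,
  ≤-byℤ (ℤₚ.i≤j⇒0≤j-i (proj₂ bounds)) eq
  where
  n = suc m
  q = a ℤ./ℕ n
  q′ = b ℤ./ℕ n
  r = a ℤ.%ℕ n
  s = b ℤ.%ℕ n
  d = (q′ ℤ.+ c) ℤ.- q
  A : a ≡ ℤ.+ r ℤ.+ q ℤ.* ℤ.+ n
  A = ℤ.a≡a%ℕn+[a/ℕn]*n a n
  B : b ≡ ℤ.+ s ℤ.+ q′ ℤ.* ℤ.+ n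
  B = ℤ.a≡a%ℕn+[a/ℕn]*n b n
  identity₁ : ∀ r s n q q′ c → (s ℤ.+ n ℤ.* ((q′ ℤ.+ c) ℤ.- q)) ℤ.- r
                               ≡ ((s ℤ.+ q′ ℤ.* n) ℤ.+ n ℤ.* c) ℤ.- (r ℤ.+ q ℤ.* n)
  identity₁ = solve-∀
  bounds : 0ℤ ℤ.≤ d × ℤ.+ r ℤ.≤ ℤ.+ s ℤ.+ ℤ.+ m ℤ.* d
  bounds = remainder-bound m r s d (ℕ.s≤s⁻¹ (ℤ.n%ℕd<d a n)) (ℕ.s≤s⁻¹ (ℤ.n%ℕd<d b n))
    (≤-byℤ (ℤₚ.i≤j⇒0≤j-i h) (≡.trans (identity₁ (ℤ.+ r) (ℤ.+ s) (ℤ.+ n) q q′ c)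
      (≡.cong₂ (λ x y → (y ℤ.+ ℤ.+ n ℤ.* c) ℤ.- x) (≡.sym A) (≡.sym B))))
  identity₂ : ∀ r s m q q′ c → (((s ℤ.+ q′ ℤ.* (1ℤ ℤ.+ m)) ℤ.- q′) ℤ.+ m ℤ.* c) ℤ.- ((r ℤ.+ q ℤ.* (1ℤ ℤ.+ m)) ℤ.- q)
                               ≡ (s ℤ.+ m ℤ.* ((q′ ℤ.+ c) ℤ.- q)) ℤ.- r
  identity₂ = solve-∀
  eq : ((b ℤ.- q′) ℤ.+ ℤ.+ m ℤ.* c) ℤ.- (a ℤ.- q) ≡ (ℤ.+ s ℤ.+ ℤ.+ m ℤ.* d) ℤ.- ℤ.+ r
  eq = ≡.trans (≡.cong₂ (λ x y → ((y ℤ.- q′) ℤ.+ ℤ.+ m ℤ.* c) ℤ.- (x ℤ.- q)) A B)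
               (identity₂ (ℤ.+ r) (ℤ.+ s) (ℤ.+ m) q q′ c)

-- Finite sums over lists.

module ListSums (R : CompleteOrderedField) where

  open CompleteOrderedField R
  open OrderedField R
  open import Relation.Binary.Reasoning.Setoid setoid

  ∑ : {A : Set} → List A → (A → Carrier) → Carrier
  ∑ l f = foldr _+_ 0# (map f l)

  ∑-cong : ∀ {A : Set} (l : List A) {f g} → (∀ {a} → a ∈ l → f a ≈ g a) → ∑ l f ≈ ∑ l g
  ∑-cong []      f≈g = refl
  ∑-cong (a ∷ l) f≈g = +-cong (f≈g (here ≡.refl)) (∑-cong l (λ a∈l → f≈g (there a∈l)))

  ∑-mono : ∀ {A : Set} (l : List A) {f g} → (∀ {a} → a ∈ l → f a ≤ g a) → ∑ l f ≤ ∑ l g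
  ∑-mono []      f≤g = ≤-refl
  ∑-mono (a ∷ l) f≤g = +-mono-≤ (f≤g (here ≡.refl)) (∑-mono l (λ a∈l → f≤g (there a∈l)))

  ∑-nonneg : ∀ {A : Set} (l : List A) {f} → (∀ {a} → a ∈ l → 0# ≤ f a) → 0# ≤ ∑ l f
  ∑-nonneg []      0≤f = ≤-refl
  ∑-nonneg (a ∷ l) 0≤f = 0≤+ (0≤f (here ≡.refl)) (∑-nonneg l (λ a∈l → 0≤f (there a∈l)))

  ∑-0 : ∀ {A : Set} (l : List A) → ∑ l (λ _ → 0#) ≈ 0#
  ∑-0 []      = refl
  ∑-0 (a ∷ l) = trans (+-identityˡ _) (∑-0 l)

  ∑-zero : ∀ {A : Set} (l : List A) {f} → (∀ {a} → a ∈ l → f a ≈ 0#) → ∑ l f ≈ 0#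
  ∑-zero l f≈0 = trans (∑-cong l f≈0) (∑-0 l)

  ∑-const : ∀ {A : Set} (l : List A) k → ∑ l (λ _ → k) ≈ fromNat (length l) * k
  ∑-const []      k = sym (zeroˡ k)
  ∑-const (a ∷ l) k = trans (+-congˡ (∑-const l k))
    (solve 2 (λ n k → k :+ n :* k := (con (ℤ.+ 1) :+ n) :* k) refl (fromNat (length l)) k)

  ∑-distrib-+ : ∀ {A : Set} (l : List A) f g → ∑ l (λ a → f a + g a) ≈ ∑ l f + ∑ l g
  ∑-distrib-+ []      f g = sym (+-identityˡ 0#)
  ∑-distrib-+ (a ∷ l) f g = trans (+-congˡ (∑-distrib-+ l f g))
    (solve 4 (λ x y u v → (x :+ y) :+ (u :+ v) := (x :+ u) :+ (y :+ v)) refl (f a) (g a) (∑ l f) (∑ l g))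

  ∑-*ˡ : ∀ {A : Set} (l : List A) k f → ∑ l (λ a → k * f a) ≈ k * ∑ l f
  ∑-*ˡ []      k f = sym (zeroʳ k)
  ∑-*ˡ (a ∷ l) k f = trans (+-congˡ (∑-*ˡ l k f)) (sym (distribˡ _ _ _))

  ∑-*ʳ : ∀ {A : Set} (l : List A) k f → ∑ l (λ a → f a * k) ≈ ∑ l f * k
  ∑-*ʳ l k f = trans (∑-cong l λ _ → *-comm _ _) (trans (∑-*ˡ l k f) (*-comm _ _))

  ∑-neg : ∀ {A : Set} (l : List A) f → ∑ l (λ a → - f a) ≈ - ∑ l f
  ∑-neg []      f = sym -0#≈0#
  ∑-neg (a ∷ l) f = trans (+-congˡ (∑-neg l f))
    (solve 2 (λ x y → (:- x) :+ (:- y) := :- (x :+ y)) refl (f a) (∑ l f))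

  ∑-swap : ∀ {A B : Set} (k : List A) (l : List B) (f : A → B → Carrier) → ∑ k (λ a → ∑ l (f a)) ≈ ∑ l (λ b → ∑ k (λ a → f a b))
  ∑-swap []      l f = sym (∑-0 l)
  ∑-swap (a ∷ k) l f = trans (+-congˡ (∑-swap k l f)) (sym (∑-distrib-+ l (f a) _))

  ∑-++ : ∀ {A : Set} (k l : List A) f → ∑ (k ++ l) f ≈ ∑ k f + ∑ l f
  ∑-++ []      l f = sym (+-identityˡ _)
  ∑-++ (a ∷ k) l f = trans (+-congˡ (∑-++ k l f)) (sym (+-assoc _ _ _))

  ∑-map : ∀ {A B : Set} (g : A → B) l f → ∑ (map g l) f ≈ ∑ l (f ∘ g)
  ∑-map g []      f = refl
  ∑-map g (a ∷ l) f = +-congˡ (∑-map g l f)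

-- Integral duality for transport networks by elimination of edges.

module Transport (R : CompleteOrderedField) (N : Set) (cost : N × N → ℤ) where

  open CompleteOrderedField R
  open OrderedField R
  open ListSums R
  open import Relation.Binary.Reasoning.Setoid setoid

  -- The list of weighted nodes stands for a signed measure. Nodes may be repeated, so that moving
  -- mass along an edge only prepends two entries.
  ⟨_,_⟩ : List (Carrier × N) → (N → ℤ) → Carrier
  ⟨ b , φ ⟩ = ∑ b (λ (r , i) → r * ι (φ i))

  ⟨⟩-+ : ∀ b φ ψ → ⟨ b , (λ i → φ i ℤ.+ ψ i) ⟩ ≈ ⟨ b , φ ⟩ + ⟨ b , ψ ⟩
  ⟨⟩-+ b φ ψ = trans (∑-cong b λ {(r , i)} _ → trans (*-congˡ (ι-+ (φ i) (ψ i))) (distribˡ _ _ _))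
                      (∑-distrib-+ b _ _)

  ⟨⟩-* : ∀ b k φ → ⟨ b , (λ i → k ℤ.* φ i) ⟩ ≈ ι k * ⟨ b , φ ⟩
  ⟨⟩-* b k φ = trans (∑-cong b λ {(r , i)} _ → trans (*-congˡ (ι-* k (φ i)))
                        (solve 3 (λ r k x → r :* (k :* x) := k :* (r :* x)) refl r (ι k) (ι (φ i))))
                      (∑-*ˡ b (ι k) _)

  Feasible : List (N × N) → (N × N → ℤ) → (N → ℤ) → Set
  Feasible E c φ = ∀ {e} → e ∈ E → φ (proj₁ e) ℤ.≤ φ (proj₂ e) ℤ.+ c e

  -- Conservation is stated weakly, by testing against all integer potentials; indicator potentials
  -- recover the balance at each node.
  IsFlow : List (N × N) → List (Carrier × N) → Carrier → List (Carrier × N × N) → Set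
  IsFlow E b M F =
    (∀ {t e} → (t , e) ∈ F → 0# ≤ t × e ∈ E) ×
    (∀ φ → ⟨ b , φ ⟩ ≈ ∑ F (λ (t , i , j) → t * (ι (φ i) - ι (φ j)))) ×
    ∑ F (λ (t , e) → t * ι (cost e)) ≤ M

  -- Integrality: a solution of the m+1 times dilated system is a sum of m+1
  -- integer solutions of the original one.
  dilated-bound : ∀ E b M → (∀ φ → Feasible E cost φ → ⟨ b , φ ⟩ ≤ M) →
    ∀ m γ → Feasible E (λ e → ℤ.+ suc m ℤ.* cost e) γ → ⟨ b , γ ⟩ ≤ fromNat (suc m) * M
  dilated-bound E b M bound zero γ γ-feas =
    ≤-respʳ-≈ (solve 1 (λ M → M := (con (ℤ.+ 1) :+ con (ℤ.+ 0)) :* M) refl M)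
      (bound γ λ {e} e∈E → ≡.subst (λ c → γ (proj₁ e) ℤ.≤ γ (proj₂ e) ℤ.+ c) (ℤₚ.*-identityˡ (cost e)) (γ-feas e∈E))
  dilated-bound E b M bound (suc m) γ γ-feas =
    ≤-respˡ-≈ (trans (sym (⟨⟩-+ b quotient rest)) (∑-cong b λ {(r , i)} _ → *-congˡ (reflexive (≡.cong ι (recombine (γ i) (quotient i))))))
      (≤-respʳ-≈ (solve 2 (λ M k → M :+ k :* M := (con (ℤ.+ 1) :+ k) :* M) refl M (fromNat (suc m)))
        (+-mono-≤
          (bound quotient λ {e} e∈E → proj₁ (quotient-bound (suc m) (γ (proj₁ e)) (γ (proj₂ e)) (cost e) (γ-feas e∈E)))
          (dilated-bound E b M bound m rest
            λ {e} e∈E → proj₂ (quotient-bound (suc m) (γ (proj₁ e)) (γ (proj₂ e)) (cost e) (γ-feas e∈E)))))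
    where
    quotient rest : N → ℤ
    quotient i = γ i ℤ./ℕ suc (suc m)
    rest i     = γ i ℤ.- quotient i
    recombine : ∀ g q → q ℤ.+ (g ℤ.- q) ≡ g
    recombine = solve-∀

  -- The multiples n φ are potentials as well, so n `⟨ b , φ ⟩` ≤ M for all n and the pairing is at
  -- most 0 by the Archimedean property. Applying this to -φ gives the reverse inequality.
  unbounded-pairing : ∀ b M → (∀ φ → ⟨ b , φ ⟩ ≤ M) → ∀ φ → ⟨ b , φ ⟩ ≈ 0#
  unbounded-pairing b M bound φ = ≤-antisym (nonpositive φ)
      (≤-by (≤⇒0≤- (≤-respˡ-≈ (⟨⟩-* b -[1+ 0 ] φ) (nonpositive (λ i → -[1+ 0 ] ℤ.* φ i))))
        (solve 1 (λ x → x :- con (ℤ.+ 0) := con (ℤ.+ 0) :- (:- (con (ℤ.+ 1) :+ con (ℤ.+ 0))) :* x) refl ⟨ b , φ ⟩))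
    where
    nonpositive : ∀ φ → ⟨ b , φ ⟩ ≤ 0#
    nonpositive φ = archimedean λ n → ≤-respˡ-≈ (⟨⟩-* b (ℤ.+ n) φ) (bound (λ i → ℤ.+ n ℤ.* φ i))

  module Elimination (e : N × N) (E : List (N × N)) (b : List (Carrier × N)) (M : Carrier)
                     (bound : ∀ φ → Feasible (e ∷ E) cost φ → ⟨ b , φ ⟩ ≤ M) where

    i = proj₁ e
    j = proj₂ e

    -- The slack at the removed edge. A weight t for that edge has to satisfy `⟨ b , φ ⟩` + t
    -- `gap φ` ≤ M for every φ feasible for `E`, so positive slacks bound t from above and negative
    -- ones from below.
    gap : (N → ℤ) → ℤ
    gap φ = (φ j ℤ.+ cost e) ℤ.- φ i

    -- Stated for arbitrary costs because `combine` applies it to dilated ones.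
    extend : ∀ {φ c} → Feasible E c φ → φ i ℤ.≤ φ j ℤ.+ c e → Feasible (e ∷ E) c φ
    extend f h (here ≡.refl) = h
    extend f h (there e∈E)   = f e∈E

    -- (β+1)φ + (α+1)ψ is tight at e, hence feasible for the dilated system of e ∷ E.
    combine : ∀ α β φ ψ → Feasible E cost φ → Feasible E cost ψ →
      gap φ ≡ -[1+ α ] → gap ψ ≡ ℤ.+ suc β →
      fromNat (suc β) * ⟨ b , φ ⟩ + fromNat (suc α) * ⟨ b , ψ ⟩ ≤ (fromNat (suc β) + fromNat (suc α)) * M
    combine α β φ ψ φ-feas ψ-feas gapφ gapψ =
      ≤-respˡ-≈ (trans (⟨⟩-+ b (λ k → ℤ.+ suc β ℤ.* φ k) (λ k → ℤ.+ suc α ℤ.* ψ k)) (+-cong (⟨⟩-* b (ℤ.+ suc β) φ) (⟨⟩-* b (ℤ.+ suc α) ψ)))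
        (≤-respʳ-≈ (*-congʳ (ι-+ (ℤ.+ suc β) (ℤ.+ suc α)))
          (dilated-bound (e ∷ E) b M bound (β ℕ.+ suc α) γ
            (extend {γ} {λ e → ℤ.+ (suc β ℕ.+ suc α) ℤ.* cost e}
              (λ {e′} e′∈E → ≤-byℤ
                (0≤+ℤ (0≤+*ℤ (suc β) (ℤₚ.i≤j⇒0≤j-i (φ-feas e′∈E))) (0≤+*ℤ (suc α) (ℤₚ.i≤j⇒0≤j-i (ψ-feas e′∈E))))
                (gap-γ (proj₁ e′) (proj₂ e′) (cost e′)))
              (≤-byℤ (ℤₚ.≤-refl) (≡.trans (gap-γ i j (cost e))
                (≡.trans (≡.cong₂ (λ x y → ℤ.+ suc β ℤ.* x ℤ.+ ℤ.+ suc α ℤ.* y) gapφ gapψ)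
                  (cancel (ℤ.+ suc β) (ℤ.+ suc α))))))))
      where
      γ : N → ℤ
      γ k = ℤ.+ suc β ℤ.* φ k ℤ.+ ℤ.+ suc α ℤ.* ψ k
      identity : ∀ s t x x′ y y′ c → ((s ℤ.* x′ ℤ.+ t ℤ.* y′) ℤ.+ (s ℤ.+ t) ℤ.* c) ℤ.- (s ℤ.* x ℤ.+ t ℤ.* y)
                 ≡ s ℤ.* ((x′ ℤ.+ c) ℤ.- x) ℤ.+ t ℤ.* ((y′ ℤ.+ c) ℤ.- y)
      identity = solve-∀
      gap-γ : ∀ i j c → (γ j ℤ.+ ℤ.+ (suc β ℕ.+ suc α) ℤ.* c) ℤ.- γ i
                 ≡ ℤ.+ suc β ℤ.* ((φ j ℤ.+ c) ℤ.- φ i) ℤ.+ ℤ.+ suc α ℤ.* ((ψ j ℤ.+ c) ℤ.- ψ i)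
      gap-γ i j c = identity (ℤ.+ suc β) (ℤ.+ suc α) (φ i) (φ j) (ψ i) (ψ j) c
      cancel : ∀ s t → s ℤ.* (ℤ.- t) ℤ.+ t ℤ.* s ≡ 0ℤ
      cancel = solve-∀

    UpperBound : Carrier → Set
    UpperBound r = ∃[ ψ ] ∃[ β ] Feasible E cost ψ × gap ψ ≡ ℤ.+ suc β × r * fromNat (suc β) ≈ M - ⟨ b , ψ ⟩

    upperBound : ∀ ψ β → Feasible E cost ψ → gap ψ ≡ ℤ.+ suc β → UpperBound ((M - ⟨ b , ψ ⟩) * fromNat (suc β) ⁻¹)
    upperBound ψ β feas eq = ψ , β , feas , eq , divide (fromNat-suc≉0 β) _

    -- A potential with positive slack at `e` is feasible for `e ∷ E` too, so `bound` makes the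
    -- numerator nonnegative. This is why the chosen weight is nonnegative.
    0≤upperBound : IsLowerBound UpperBound 0#
    0≤upperBound r (ψ , β , feas , eq , r-eq) = *-cancelˡ-≤ (0≤fromNat (suc β)) (fromNat-suc≉0 β)
      (≤-respˡ-≈ (sym (zeroʳ _)) (≤-respʳ-≈ (trans (sym r-eq) (*-comm _ _))
        (≤⇒0≤- (bound ψ (extend feas (ℤₚ.0≤i-j⇒j≤i (≡.subst (0ℤ ℤ.≤_) (≡.sym eq) (+≤+ z≤n))))))))

    module Step (φ₀ : N → ℤ) (β₀ : ℕ) (φ₀-feas : Feasible E cost φ₀) (gapφ₀ : gap φ₀ ≡ ℤ.+ suc β₀) where

      t : Carrier
      t = inf UpperBound

      -- `φ₀` supplies one upper bound; the value of `inf` on an empty set would be unspecified.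
      t-isInf : IsInfimum UpperBound t
      t-isInf = inf-isInfimum UpperBound (_ , upperBound φ₀ β₀ φ₀-feas gapφ₀) (0# , 0≤upperBound)

      0≤t : 0# ≤ t
      0≤t = proj₂ t-isInf 0# 0≤upperBound

      -- By the sign of the slack. Slack zero is covered by `bound`; for positive slack t lies below
      -- the upper bound that φ gives; negative slack gives a lower bound `r₀`, which `combine`
      -- places below every upper bound and hence below their infimum.
      t-bound : ∀ φ → Feasible E cost φ → ⟨ b , φ ⟩ + t * ι (gap φ) ≤ M
      t-bound φ feas with gap φ in eq
      ... | ℤ.+ zero  = ≤-respˡ-≈ (solve 2 (λ x t → x := x :+ t :* con (ℤ.+ 0)) refl ⟨ b , φ ⟩ t)
        (bound φ (extend feas (ℤₚ.0≤i-j⇒j≤i (≡.subst (0ℤ ℤ.≤_) (≡.sym eq) (+≤+ z≤n)))))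
      ... | ℤ.+ suc β = ≤-by (≤⇒0≤- (≤-respʳ-≈ (divide (fromNat-suc≉0 β) _)
          (*-monoʳ-≤ (0≤fromNat (suc β)) (proj₁ t-isInf _ (upperBound φ β feas eq)))))
        (solve 3 (λ x y M → M :- (x :+ y) := (M :- x) :- y) refl ⟨ b , φ ⟩ (t * fromNat (suc β)) M)
      ... | -[1+ α ]  = ≤-by (≤⇒0≤- (≤-respˡ-≈ (divide (fromNat-suc≉0 α) _)
          (*-monoʳ-≤ (0≤fromNat (suc α)) (proj₂ t-isInf r₀ r₀≤))))
        (solve 4 (λ x t k M → M :- (x :+ t :* (:- k)) := t :* k :- (x :- M)) refl ⟨ b , φ ⟩ t (fromNat (suc α)) M)
        where
        r₀ : Carrier
        r₀ = (⟨ b , φ ⟩ - M) * fromNat (suc α) ⁻¹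
        r₀≤ : IsLowerBound UpperBound r₀
        r₀≤ r (ψ , β , ψ-feas , gapψ , r-eq) =
          *-cancelˡ-≤ (0≤fromNat (suc α)) (fromNat-suc≉0 α) (*-cancelˡ-≤ (0≤fromNat (suc β)) (fromNat-suc≉0 β)
            (≤-by (≤⇒0≤- (combine α β φ ψ feas ψ-feas eq gapψ)) (begin
              B * (A * r) - B * (A * r₀)     ≈⟨ solve 4 (λ A B r r₀ → B :* (A :* r) :- B :* (A :* r₀) := A :* (r :* B) :- B :* (r₀ :* A)) refl A B r r₀ ⟩
              A * (r * B) - B * (r₀ * A)     ≈⟨ +-cong (*-congˡ r-eq) (-‿cong (*-congˡ (divide (fromNat-suc≉0 α) _))) ⟩
              A * (M - ⟨ b , ψ ⟩) - B * (⟨ b , φ ⟩ - M)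
                ≈⟨ solve 5 (λ A B M x y → A :* (M :- y) :- B :* (x :- M) := (B :+ A) :* M :- (B :* x :+ A :* y)) refl A B M ⟨ b , φ ⟩ ⟨ b , ψ ⟩ ⟩
              (B + A) * M - (B * ⟨ b , φ ⟩ + A * ⟨ b , ψ ⟩) ∎)))
          where
          A = fromNat (suc α)
          B = fromNat (suc β)

  -- Induction on the edges. Giving `e` the weight t turns `b` into `b′` and the budget `M` into M -
  -- t `cost e`, and `t-bound` becomes the hypothesis for the remaining edges. With no edges left
  -- every potential is feasible, so the pairing vanishes and 0 ≤ M. Strictness of `φ₀` gives each
  -- edge positive slack when its turn comes.
  duality : ∀ E b M (φ₀ : N → ℤ) → (∀ {e} → e ∈ E → φ₀ (proj₁ e) ℤ.< φ₀ (proj₂ e) ℤ.+ cost e) →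
    (∀ φ → Feasible E cost φ → ⟨ b , φ ⟩ ≤ M) → ∃ (IsFlow E b M)
  duality [] b M φ₀ _ bound =
    [] , (λ ()) , vanishes , ≤-respˡ-≈ (vanishes φ₀) (bound φ₀ λ ())
    where
    vanishes : ∀ φ → ⟨ b , φ ⟩ ≈ 0#
    vanishes = unbounded-pairing b M (λ φ → bound φ λ ())
  duality (e ∷ E) b M φ₀ strict bound =
    (t , e) ∷ F , weights , decomposition , cost≤M
    where
    open Elimination e E b M bound
    positive : ∀ {g} → 0ℤ ℤ.< g → ∃[ β ] g ≡ ℤ.+ suc β
    positive {ℤ.+ suc β} _ = β , ≡.refl
    positive {ℤ.+ zero} (ℤ.+<+ ())
    gapφ₀ : ∃[ β ] gap φ₀ ≡ ℤ.+ suc β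
    gapφ₀ = positive (≡.subst (ℤ._< gap φ₀) (ℤₚ.+-inverseʳ (φ₀ i)) (ℤₚ.+-monoˡ-< (ℤ.- φ₀ i) (strict (here ≡.refl))))
    open Step φ₀ (proj₁ gapφ₀) (λ e∈E → ℤₚ.<⇒≤ (strict (there e∈E))) (proj₂ gapφ₀)
    b′ : List (Carrier × N)
    b′ = (- t , i) ∷ (t , j) ∷ b
    bound′ : ∀ φ → Feasible E cost φ → ⟨ b′ , φ ⟩ ≤ M - t * ι (cost e)
    bound′ φ feas = ≤-by (≤⇒0≤- (t-bound φ feas)) (begin
      (M - t * ι (cost e)) - (- t * ι (φ i) + (t * ι (φ j) + ⟨ b , φ ⟩))
        ≈⟨ solve 6 (λ M t c x y p → (M :- t :* c) :- ((:- t) :* x :+ (t :* y :+ p)) := M :- (p :+ t :* ((y :+ c) :- x)))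
                   refl M t (ι (cost e)) (ι (φ i)) (ι (φ j)) ⟨ b , φ ⟩ ⟩
      M - (⟨ b , φ ⟩ + t * ((ι (φ j) + ι (cost e)) - ι (φ i)))
        ≈⟨ +-congˡ (-‿cong (+-congˡ (*-congˡ (trans (ι-- (φ j ℤ.+ cost e) (φ i)) (+-congʳ (ι-+ (φ j) (cost e))))))) ⟨
      M - (⟨ b , φ ⟩ + t * ι (gap φ)) ∎)
    IH : ∃ (IsFlow E b′ (M - t * ι (cost e)))
    IH = duality E b′ (M - t * ι (cost e)) φ₀ (λ e∈E → strict (there e∈E)) bound′
    F : List (Carrier × N × N)
    F = proj₁ IH
    weights : ∀ {s e′} → (s , e′) ∈ (t , e) ∷ F → 0# ≤ s × e′ ∈ e ∷ E
    weights (here ≡.refl) = 0≤t , here ≡.refl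
    weights (there s∈F)   = proj₁ (proj₁ (proj₂ IH) s∈F) , there (proj₂ (proj₁ (proj₂ IH) s∈F))
    decomposition : ∀ φ → ⟨ b , φ ⟩ ≈ ∑ ((t , e) ∷ F) (λ (s , i , j) → s * (ι (φ i) - ι (φ j)))
    decomposition φ = trans
      (solve 4 (λ t x y p → p := t :* (x :- y) :+ ((:- t) :* x :+ (t :* y :+ p))) refl t (ι (φ i)) (ι (φ j)) ⟨ b , φ ⟩)
      (+-congˡ (proj₁ (proj₂ (proj₂ IH)) φ))
    cost≤M : ∑ ((t , e) ∷ F) (λ (s , e′) → s * ι (cost e′)) ≤ M
    cost≤M = ≤-by (≤⇒0≤- (proj₂ (proj₂ (proj₂ IH))))
      (solve 3 (λ M k r → M :- (k :+ r) := (M :- k) :- r) refl M (t * ι (cost e)) (∑ F (λ (s , e′) → s * ι (cost e′))))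

-- Indicators and sums of finitely supported families.

module FiniteSupport (em : ExcludedMiddle 0ℓ) (R : CompleteOrderedField) where

  open CompleteOrderedField R
  open OrderedField R
  open ListSums R
  open import Relation.Binary.Reasoning.Setoid setoid

  -- Integer valued, so that it can serve as a potential against which a flow is tested.
  𝟙ℤ : {A : Set} → A → A → ℤ
  𝟙ℤ a b with em {a ≡ b}
  ... | yes _ = 1ℤ
  ... | no _  = 0ℤ

  𝟙 : {A : Set} → A → A → Carrier
  𝟙 a b = ι (𝟙ℤ a b)

  𝟙-refl : ∀ {A : Set} (a : A) → 𝟙 a a ≈ 1#
  𝟙-refl a with em {a ≡ a}
  ... | yes _  = +-identityʳ 1#
  ... | no a≢a = ⊥-elim (a≢a ≡.refl)

  𝟙-≢ : ∀ {A : Set} {a b : A} → a ≢ b → 𝟙 a b ≈ 0#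
  𝟙-≢ {a = a} {b} a≢b with em {a ≡ b}
  ... | yes a≡b = ⊥-elim (a≢b a≡b)
  ... | no _    = refl

  0≤𝟙 : ∀ {A : Set} (a b : A) → 0# ≤ 𝟙 a b
  0≤𝟙 a b with em {a ≡ b}
  ... | yes _ = 0≤fromNat 1
  ... | no _  = ≤-refl

  -- `k` will be the identity or an inclusion of the vertices into the nodes of the transport
  -- network.
  module _ {A B : Set} (k : A → B) (k-injective : ∀ {a b} → k a ≡ k b → a ≡ b) (f : A → Carrier) where

    ∑-𝟙-∉ : ∀ l {a} → a ∉ l → ∑ l (λ b → f b * 𝟙 (k a) (k b)) ≈ 0#
    ∑-𝟙-∉ l a∉l = ∑-zero l λ b∈l →
      trans (*-congˡ (𝟙-≢ λ eq → a∉l (≡.subst (_∈ l) (≡.sym (k-injective eq)) b∈l))) (zeroʳ _)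

    ∑-𝟙-∈ : ∀ {l a} → Unique l → a ∈ l → ∑ l (λ b → f b * 𝟙 (k a) (k b)) ≈ f a
    ∑-𝟙-∈ {a ∷ l} (a∉l ∷ _) (here ≡.refl) =
      trans (+-cong (trans (*-congˡ (𝟙-refl (k a))) (*-identityʳ _)) (∑-𝟙-∉ l λ a∈l → All.lookup a∉l a∈l ≡.refl)) (+-identityʳ _)
    ∑-𝟙-∈ (b∉l ∷ u) (there a∈l) =
      trans (+-cong (trans (*-congˡ (𝟙-≢ λ eq → All.lookup b∉l a∈l (≡.sym (k-injective eq)))) (zeroʳ _)) (∑-𝟙-∈ u a∈l)) (+-identityˡ _)

    ∑-𝟙-supported : ∀ {l} → Unique l → (∀ a → a ∉ l → f a ≈ 0#) → ∀ a → ∑ l (λ b → f b * 𝟙 (k a) (k b)) ≈ f a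
    ∑-𝟙-supported {l} u f≈0 a with em {a ∈ l}
    ... | yes a∈l = ∑-𝟙-∈ u a∈l
    ... | no a∉l  = trans (∑-𝟙-∉ l a∉l) (sym (f≈0 a a∉l))

  ∑-𝟙≤1 : ∀ {A : Set} {l : List A} → Unique l → ∀ a → ∑ l (λ b → 𝟙 a b) ≤ 1#
  ∑-𝟙≤1 {l = l} u a = ≤-respˡ-≈ (∑-cong l λ _ → *-identityˡ _) bound
    where
    bound : ∑ l (λ b → 1# * 𝟙 a b) ≤ 1#
    bound with em {a ∈ l}
    ... | yes a∈l = ≤-reflexive (∑-𝟙-∈ id id (λ _ → 1#) u a∈l)
    ... | no a∉l  = ≤-respˡ-≈ (sym (∑-𝟙-∉ id id (λ _ → 1#) l a∉l)) 0≤1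

  𝟙-sym : ∀ {A : Set} (a b : A) → 𝟙 a b ≈ 𝟙 b a
  𝟙-sym a b with em {a ≡ b}
  ... | yes ≡.refl = trans (+-identityʳ 1#) (sym (𝟙-refl a))
  ... | no a≢b     = sym (𝟙-≢ (a≢b ∘ ≡.sym))

  -- For any repetition-free list `k`, inserting indicators and exchanging the sums weights each
  -- value on `l` by its number of occurrences in `k`, which is at most 1. So no partial sum exceeds
  -- the one over `l`.
  HasSum-finite : ∀ {A : Set} {f : A → Carrier} {l} → (∀ a → 0# ≤ f a) → Unique l →
    (∀ a → a ∉ l → f a ≈ 0#) → HasSum f (∑ l f)
  HasSum-finite {f = f} {l} 0≤f u f≈0 =
      (λ _ (k , uₖ , eq) → ≤-respˡ-≈ (sym eq) (partial≤ k uₖ)) ,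
      (λ _ bound → bound _ (l , u , refl))
    where
    partial≤ : ∀ k → Unique k → ∑ k f ≤ ∑ l f
    partial≤ k uₖ = ≤-respˡ-≈ (sym expand) (∑-mono l λ {b} _ →
        ≤-respʳ-≈ (*-identityʳ (f b)) (*-monoˡ-≤ (0≤f b) (∑-𝟙≤1 uₖ b)))
      where
      expand : ∑ k f ≈ ∑ l (λ b → f b * ∑ k (λ a → 𝟙 b a))
      expand = begin
        ∑ k f                                    ≈⟨ ∑-cong k (λ {a} _ → ∑-𝟙-supported id id f u f≈0 a) ⟨
        ∑ k (λ a → ∑ l (λ b → f b * 𝟙 a b))      ≈⟨ ∑-swap k l _ ⟩
        ∑ l (λ b → ∑ k (λ a → f b * 𝟙 a b))      ≈⟨ ∑-cong l (λ {b} _ → ∑-*ˡ k (f b) (λ a → 𝟙 a b)) ⟩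
        ∑ l (λ b → f b * ∑ k (λ a → 𝟙 a b))      ≈⟨ ∑-cong l (λ {b} _ → *-congˡ (∑-cong k (λ {a} _ → 𝟙-sym a b))) ⟩
        ∑ l (λ b → f b * ∑ k (λ a → 𝟙 b a))      ∎

  HasSum-unique : ∀ {A : Set} {f : A → Carrier} {s t} → HasSum f s → HasSum f t → s ≈ t
  HasSum-unique (s-upper , s-least) (t-upper , t-least) = ≤-antisym (s-least _ t-upper) (t-least _ s-upper)

  HasSum-resp-≈ : ∀ {A : Set} {f : A → Carrier} {s t} → s ≈ t → HasSum f s → HasSum f t
  HasSum-resp-≈ s≈t (upper , least) = (λ c Sc → ≤-respʳ-≈ s≈t (upper c Sc)) , (λ a h → ≤-respˡ-≈ s≈t (least a h))

  HasSum-term≤ : ∀ {A : Set} {f : A → Carrier} {s} → HasSum f s → ∀ a → f a ≤ s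
  HasSum-term≤ (upper , _) a = ≤-respˡ-≈ (+-identityʳ _) (upper _ (a ∷ [] , ([] ∷ []) , refl))

-- Kantorovich duality for finitely supported measures.

module Kantorovich (em : ExcludedMiddle 0ℓ) (R : CompleteOrderedField) (G : LocallyFiniteGraph) where

  open Curvature em R G
  open OrderedField R
  open ListSums R
  open FiniteSupport em R
  open import Relation.Binary.Reasoning.Setoid setoid

  module OnSupports
    (A B : List V) (uA : Unique A) (uB : Unique B)
    (D : V → V → ℕ) (dist≡D : ∀ {a b} → a ∈ A → b ∈ B → dist a b ≡ [ D a b ])
    (m₁ m₂ : V → Carrier)
    (m₁≤1 : ∀ v → m₁ v ≤ 1#)
    (m₁-support : ∀ v → v ∉ A → m₁ v ≈ 0#) (m₂-support : ∀ v → v ∉ B → m₂ v ≈ 0#)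
    where

    Feasible : (u v : V → ℤ) → Set
    Feasible u v = ∀ {a b} → a ∈ A → b ∈ B → u a ℤ.≤ v b ℤ.+ ℤ.+ D a b

    dual : (u v : V → ℤ) → Carrier
    dual u v = ∑ A (λ a → m₁ a * ι (u a)) - ∑ B (λ b → m₂ b * ι (v b))

    DualValue Cost : Carrier → Set
    DualValue s = ∃[ u ] ∃[ v ] Feasible u v × s ≈ dual u v
    Cost c = ∃[ π ] IsCoupling m₁ m₂ π × HasCost π c

    -- The marginals vanish off `A` and `B`, hence so does π, and the marginal sums become finite.
    -- The dual value turns into the sum of π(a,b) (u(a) - v(b)), which feasibility bounds by a
    -- partial sum of the cost.
    weak-duality : ∀ {u v c} → Feasible u v → Cost c → dual u v ≤ c
    weak-duality {u} {v} {c} feas (π , (π∈[0,1] , rows , columns) , term , row , products , row-sums , total) =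
      ≤-trans (≤-respˡ-≈ (sym dual≈) (∑-mono A λ {a} a∈A → ∑-mono B λ {b} b∈B → π*gap≤term a∈A b∈B)) ∑term≤c
      where
      π-zeroˡ : ∀ a b → a ∉ A → π a b ≈ 0#
      π-zeroˡ a b a∉A = ≤-antisym (≤-respʳ-≈ (m₁-support a a∉A) (HasSum-term≤ (rows a) b)) (proj₁ (π∈[0,1] a b))
      π-zeroʳ : ∀ a b → b ∉ B → π a b ≈ 0#
      π-zeroʳ a b b∉B = ≤-antisym (≤-respʳ-≈ (m₂-support b b∉B) (HasSum-term≤ (columns b) a)) (proj₁ (π∈[0,1] a b))
      m₁≈ : ∀ a → m₁ a ≈ ∑ B (λ b → π a b)
      m₁≈ a = HasSum-unique (rows a) (HasSum-finite (λ b → proj₁ (π∈[0,1] a b)) uB (λ b → π-zeroʳ a b))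
      m₂≈ : ∀ b → m₂ b ≈ ∑ A (λ a → π a b)
      m₂≈ b = HasSum-unique (columns b) (HasSum-finite (λ a → proj₁ (π∈[0,1] a b)) uA (λ a → π-zeroˡ a b))
      dual≈ : dual u v ≈ ∑ A (λ a → ∑ B (λ b → π a b * (ι (u a) - ι (v b))))
      dual≈ = begin
        ∑ A (λ a → m₁ a * ι (u a)) - ∑ B (λ b → m₂ b * ι (v b))
          ≈⟨ +-cong (∑-cong A λ {a} _ → trans (*-congʳ (m₁≈ a)) (sym (∑-*ʳ B (ι (u a)) _)))
                    (-‿cong (trans (∑-cong B λ {b} _ → trans (*-congʳ (m₂≈ b)) (sym (∑-*ʳ A (ι (v b)) _)))
                                   (∑-swap B A (λ b a → π a b * ι (v b))))) ⟩
        ∑ A (λ a → ∑ B (λ b → π a b * ι (u a))) - ∑ A (λ a → ∑ B (λ b → π a b * ι (v b)))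
          ≈⟨ +-congˡ (∑-neg A _) ⟨
        ∑ A (λ a → ∑ B (λ b → π a b * ι (u a))) + ∑ A (λ a → - ∑ B (λ b → π a b * ι (v b)))
          ≈⟨ ∑-distrib-+ A _ _ ⟨
        ∑ A (λ a → ∑ B (λ b → π a b * ι (u a)) - ∑ B (λ b → π a b * ι (v b)))
          ≈⟨ ∑-cong A (λ {a} _ → trans (+-congˡ (sym (∑-neg B _))) (sym (∑-distrib-+ B _ _))) ⟩
        ∑ A (λ a → ∑ B (λ b → π a b * ι (u a) - π a b * ι (v b)))
          ≈⟨ ∑-cong A (λ {a} _ → ∑-cong B (λ {b} _ →
               solve 3 (λ p x y → p :* x :- p :* y := p :* (x :- y)) refl (π a b) (ι (u a)) (ι (v b)))) ⟩
        ∑ A (λ a → ∑ B (λ b → π a b * (ι (u a) - ι (v b)))) ∎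
      π*gap≤term : ∀ {a b} → a ∈ A → b ∈ B → π a b * (ι (u a) - ι (v b)) ≤ term a b
      π*gap≤term {a} {b} a∈A b∈B = ≤-respʳ-≈
        (sym (trans (≡.subst (λ d → IsProduct d (π a b) (term a b)) (dist≡D a∈A b∈B) (products a b)) (*-comm _ _)))
        (*-monoˡ-≤ (proj₁ (π∈[0,1] a b)) (≤-by (≤⇒0≤- (≤-respʳ-≈ (ι-+ (v b) (ℤ.+ D a b)) (ι-mono-≤ (feas a∈A b∈B))))
          (solve 3 (λ x y d → d :- (x :- y) := (y :+ d) :- x) refl (ι (u a)) (ι (v b)) (fromNat (D a b)))))
      ∑term≤c : ∑ A (λ a → ∑ B (λ b → term a b)) ≤ c
      ∑term≤c = ≤-trans (∑-mono A λ {a} _ → proj₁ (row-sums a) _ (B , uB , refl)) (proj₁ total _ (A , uA , refl))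

    private
      -- One copy of the vertices for sources and one for sinks, since the supports may overlap.
      N : Set
      N = V ⊎ V

      cost : N × N → ℤ
      cost (inj₁ a , inj₂ b) = ℤ.+ D a b
      cost _                 = 0ℤ

      open Transport R N cost using (⟨_,_⟩; IsFlow; duality)

      E : List (N × N)
      E = cartesianProductWith (λ a b → inj₁ a , inj₂ b) A B

      net : List (Carrier × N)
      net = map (λ a → m₁ a , inj₁ a) A ++ map (λ b → - m₂ b , inj₂ b) B

      ⟨net⟩ : ∀ φ → ⟨ net , φ ⟩ ≈ dual (φ ∘ inj₁) (φ ∘ inj₂)
      ⟨net⟩ φ = begin
        ⟨ net , φ ⟩
          ≈⟨ ∑-++ (map (λ a → m₁ a , inj₁ a) A) _ _ ⟩
        ∑ (map (λ a → m₁ a , inj₁ a) A) _ + ∑ (map (λ b → - m₂ b , inj₂ b) B) _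
          ≈⟨ +-cong (∑-map _ A _) (∑-map _ B _) ⟩
        ∑ A (λ a → m₁ a * ι (φ (inj₁ a))) + ∑ B (λ b → - m₂ b * ι (φ (inj₂ b)))
          ≈⟨ +-congˡ (trans (∑-cong B λ _ → sym (-‿distribˡ-* _ _)) (∑-neg B _)) ⟩
        dual (φ ∘ inj₁) (φ ∘ inj₂) ∎

      -- Distances are nonnegative, so lowering all sources by 1 makes every constraint strict, as
      -- `duality` requires.
      φ₀ : N → ℤ
      φ₀ (inj₁ _) = -1ℤ
      φ₀ (inj₂ _) = 0ℤ

      φ₀-strict : ∀ {e} → e ∈ E → φ₀ (proj₁ e) ℤ.< φ₀ (proj₂ e) ℤ.+ cost e
      φ₀-strict e∈E with ∈-cartesianProductWith⁻ (λ a b → inj₁ a , inj₂ b) A B e∈E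
      ... | a , b , _ , _ , ≡.refl = ℤ.-<+

    module FromFlow (M : Carrier) (F : List (Carrier × N × N)) (isFlow : IsFlow E net M F) where

      edge : ∀ {t i j} → (t , i , j) ∈ F → ∃[ a ] ∃[ b ] a ∈ A × b ∈ B × (i , j) ≡ (inj₁ a , inj₂ b)
      edge t∈F = ∈-cartesianProductWith⁻ (λ a b → inj₁ a , inj₂ b) A B (proj₂ (proj₁ isFlow t∈F))

      -- Adds up all flow entries from v to w, as `IsFlow` permits an edge to be listed more than
      -- once.
      π : V → V → Carrier
      π v w = ∑ F (λ (t , i , j) → t * (𝟙 i (inj₁ v) * 𝟙 j (inj₂ w)))

      0≤π : ∀ v w → 0# ≤ π v w
      0≤π v w = ∑-nonneg F λ {(t , i , j)} t∈F → *-nonNeg (proj₁ (proj₁ isFlow t∈F)) (*-nonNeg (0≤𝟙 _ _) (0≤𝟙 _ _))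

      π-zeroˡ : ∀ v w → v ∉ A → π v w ≈ 0#
      π-zeroˡ v w v∉A = ∑-zero F λ {(t , i , j)} t∈F → vanish (edge t∈F)
        where
        vanish : ∀ {t i j} → ∃[ a ] ∃[ b ] a ∈ A × b ∈ B × (i , j) ≡ (inj₁ a , inj₂ b) →
          t * (𝟙 i (inj₁ v) * 𝟙 j (inj₂ w)) ≈ 0#
        vanish (a , b , a∈A , b∈B , ≡.refl) = trans (*-congˡ (trans (*-congʳ (𝟙-≢
          λ eq → v∉A (≡.subst (_∈ A) (inj₁-injective eq) a∈A))) (zeroˡ _))) (zeroʳ _)

      π-zeroʳ : ∀ v w → w ∉ B → π v w ≈ 0#
      π-zeroʳ v w w∉B = ∑-zero F λ {(t , i , j)} t∈F → vanish (edge t∈F)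
        where
        vanish : ∀ {t i j} → ∃[ a ] ∃[ b ] a ∈ A × b ∈ B × (i , j) ≡ (inj₁ a , inj₂ b) →
          t * (𝟙 i (inj₁ v) * 𝟙 j (inj₂ w)) ≈ 0#
        vanish (a , b , a∈A , b∈B , ≡.refl) = trans (*-congˡ (trans (*-congˡ (𝟙-≢
          λ eq → w∉B (≡.subst (_∈ B) (inj₂-injective eq) b∈B))) (zeroʳ _))) (zeroʳ _)

      sumB : ∀ {b} → b ∈ B → ∑ B (λ w → 𝟙 (inj₂ {A = V} b) (inj₂ w)) ≈ 1#
      sumB b∈B = trans (∑-cong B λ _ → sym (*-identityˡ _)) (∑-𝟙-∈ inj₂ inj₂-injective (λ _ → 1#) uB b∈B)

      sumA : ∀ {a} → a ∈ A → ∑ A (λ v → 𝟙 (inj₁ {B = V} a) (inj₁ v)) ≈ 1#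
      sumA a∈A = trans (∑-cong A λ _ → sym (*-identityˡ _)) (∑-𝟙-∈ inj₁ inj₁-injective (λ _ → 1#) uA a∈A)

      -- Test the flow with the indicator of the source copy of v. Every head of an edge is a sink,
      -- so the flow side is the total weight leaving v, and the mass side is `m₁ v`.
      row-sum : ∀ v → ∑ B (λ w → π v w) ≈ m₁ v
      row-sum v = begin
        ∑ B (λ w → π v w)
          ≈⟨ ∑-swap B F _ ⟩
        ∑ F (λ (t , i , j) → ∑ B (λ w → t * (𝟙 i (inj₁ v) * 𝟙 j (inj₂ w))))
          ≈⟨ ∑-cong F (λ t∈F → evaluate (edge t∈F)) ⟩
        ∑ F (λ (t , i , j) → t * (ι (𝟙ℤ (inj₁ v) i) - ι (𝟙ℤ (inj₁ v) j)))
          ≈⟨ proj₁ (proj₂ isFlow) (𝟙ℤ (inj₁ v)) ⟨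
        ⟨ net , 𝟙ℤ (inj₁ v) ⟩
          ≈⟨ ⟨net⟩ (𝟙ℤ (inj₁ v)) ⟩
        ∑ A (λ a → m₁ a * 𝟙 (inj₁ v) (inj₁ a)) - ∑ B (λ b → m₂ b * 𝟙 (inj₁ v) (inj₂ b))
          ≈⟨ +-cong (∑-𝟙-supported inj₁ inj₁-injective m₁ uA m₁-support v)
                    (-‿cong (∑-zero B λ _ → trans (*-congˡ (𝟙-≢ λ ())) (zeroʳ _))) ⟩
        m₁ v - 0#
          ≈⟨ solve 1 (λ x → x :- con 0ℤ := x) refl (m₁ v) ⟩
        m₁ v ∎
        where
        evaluate : ∀ {t i j} → ∃[ a ] ∃[ b ] a ∈ A × b ∈ B × (i , j) ≡ (inj₁ a , inj₂ b) →
          ∑ B (λ w → t * (𝟙 i (inj₁ v) * 𝟙 j (inj₂ w))) ≈ t * (𝟙 (inj₁ v) i - 𝟙 (inj₁ v) j)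
        evaluate {t} (a , b , _ , b∈B , ≡.refl) = begin
          ∑ B (λ w → t * (𝟙 (inj₁ a) (inj₁ v) * 𝟙 (inj₂ b) (inj₂ w)))
            ≈⟨ trans (∑-*ˡ B t _) (*-congˡ (∑-*ˡ B (𝟙 (inj₁ a) (inj₁ v)) _)) ⟩
          t * (𝟙 (inj₁ a) (inj₁ v) * ∑ B (λ w → 𝟙 (inj₂ b) (inj₂ w)))
            ≈⟨ *-congˡ (*-cong (𝟙-sym _ _) (sumB b∈B)) ⟩
          t * (𝟙 (inj₁ v) (inj₁ a) * 1#)
            ≈⟨ *-congˡ (solve 1 (λ x → x :* con 1ℤ := x :- con 0ℤ) refl _) ⟩
          t * (𝟙 (inj₁ v) (inj₁ a) - 0#)
            ≈⟨ *-congˡ (+-congˡ (-‿cong (𝟙-≢ λ ()))) ⟨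
          t * (𝟙 (inj₁ v) (inj₁ a) - 𝟙 (inj₁ v) (inj₂ b)) ∎

      -- As for `row-sum`, with the indicator of the sink copy of w. It enters negatively on both
      -- sides, whence the negations.
      column-sum : ∀ w → ∑ A (λ v → π v w) ≈ m₂ w
      column-sum w = begin
        ∑ A (λ v → π v w)
          ≈⟨ ∑-swap A F _ ⟩
        ∑ F (λ (t , i , j) → ∑ A (λ v → t * (𝟙 i (inj₁ v) * 𝟙 j (inj₂ w))))
          ≈⟨ ∑-cong F (λ t∈F → evaluate (edge t∈F)) ⟩
        ∑ F (λ (t , i , j) → - (t * (ι (𝟙ℤ (inj₂ w) i) - ι (𝟙ℤ (inj₂ w) j))))
          ≈⟨ ∑-neg F _ ⟩
        - ∑ F (λ (t , i , j) → t * (ι (𝟙ℤ (inj₂ w) i) - ι (𝟙ℤ (inj₂ w) j)))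
          ≈⟨ -‿cong (proj₁ (proj₂ isFlow) (𝟙ℤ (inj₂ w))) ⟨
        - ⟨ net , 𝟙ℤ (inj₂ w) ⟩
          ≈⟨ -‿cong (⟨net⟩ (𝟙ℤ (inj₂ w))) ⟩
        - (∑ A (λ a → m₁ a * 𝟙 (inj₂ w) (inj₁ a)) - ∑ B (λ b → m₂ b * 𝟙 (inj₂ w) (inj₂ b)))
          ≈⟨ -‿cong (+-cong (∑-zero A λ _ → trans (*-congˡ (𝟙-≢ λ ())) (zeroʳ _))
                    (-‿cong (∑-𝟙-supported inj₂ inj₂-injective m₂ uB m₂-support w))) ⟩
        - (0# - m₂ w)
          ≈⟨ solve 1 (λ x → :- (con 0ℤ :- x) := x) refl (m₂ w) ⟩
        m₂ w ∎
        where
        evaluate : ∀ {t i j} → ∃[ a ] ∃[ b ] a ∈ A × b ∈ B × (i , j) ≡ (inj₁ a , inj₂ b) →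
          ∑ A (λ v → t * (𝟙 i (inj₁ v) * 𝟙 j (inj₂ w))) ≈ - (t * (𝟙 (inj₂ w) i - 𝟙 (inj₂ w) j))
        evaluate {t} (a , b , a∈A , _ , ≡.refl) = begin
          ∑ A (λ v → t * (𝟙 (inj₁ a) (inj₁ v) * 𝟙 (inj₂ b) (inj₂ w)))
            ≈⟨ trans (∑-*ˡ A t _) (*-congˡ (∑-*ʳ A (𝟙 (inj₂ b) (inj₂ w)) _)) ⟩
          t * (∑ A (λ v → 𝟙 (inj₁ a) (inj₁ v)) * 𝟙 (inj₂ b) (inj₂ w))
            ≈⟨ *-congˡ (*-cong (sumA a∈A) (𝟙-sym _ _)) ⟩
          t * (1# * 𝟙 (inj₂ w) (inj₂ b))
            ≈⟨ solve 2 (λ t x → t :* (con 1ℤ :* x) := :- (t :* (con 0ℤ :- x))) refl t _ ⟩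
          - (t * (0# - 𝟙 (inj₂ w) (inj₂ b)))
            ≈⟨ -‿cong (*-congˡ (+-congʳ (𝟙-≢ λ ()))) ⟨
          - (t * (𝟙 (inj₂ w) (inj₁ a) - 𝟙 (inj₂ w) (inj₂ b))) ∎

      isCoupling : IsCoupling m₁ m₂ π
      isCoupling = (λ v w → 0≤π v w , ≤-trans (HasSum-term≤ (rows v) w) (m₁≤1 v)) , rows , columns
        where
        rows : ∀ v → HasSum (λ w → π v w) (m₁ v)
        rows v = HasSum-resp-≈ (row-sum v) (HasSum-finite (0≤π v) uB (π-zeroʳ v))
        columns : ∀ w → HasSum (λ v → π v w) (m₂ w)
        columns w = HasSum-resp-≈ (column-sum w) (HasSum-finite (λ v → 0≤π v w) uA (λ v → π-zeroˡ v w))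

      term : V → V → Carrier
      term v w = fromNat (D v w) * π v w

      0≤term : ∀ v w → 0# ≤ term v w
      0≤term v w = *-nonNeg (0≤fromNat (D v w)) (0≤π v w)

      -- Outside the supports the distance may be infinite; the convention ∞ · 0 = 0 makes the cost
      -- term vanish there.
      IsProduct-zero : ∀ d {m c} → m ≈ 0# → c ≈ 0# → IsProduct d m c
      IsProduct-zero [ n ] m≈0 c≈0 = trans c≈0 (sym (trans (*-congˡ m≈0) (zeroʳ _)))
      IsProduct-zero ⊤⁺    m≈0 c≈0 = m≈0 , c≈0

      term-zero : ∀ v w → π v w ≈ 0# → term v w ≈ 0#
      term-zero v w π≈0 = trans (*-congˡ π≈0) (zeroʳ _)

      hasCost : HasCost π (∑ A (λ v → ∑ B (λ w → term v w)))
      hasCost = term , (λ v → ∑ B (term v)) , products ,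
        (λ v → HasSum-finite (0≤term v) uB (λ w w∉B → term-zero v w (π-zeroʳ v w w∉B))) ,
        HasSum-finite (λ v → ∑-nonneg B (λ {w} _ → 0≤term v w)) uA
          (λ v v∉A → ∑-zero B (λ {w} _ → term-zero v w (π-zeroˡ v w v∉A)))
        where
        products : ∀ v w → IsProduct (dist v w) (π v w) (term v w)
        products v w with em {v ∈ A} | em {w ∈ B}
        ... | yes v∈A | yes w∈B = ≡.subst (λ d → IsProduct d (π v w) (term v w)) (≡.sym (dist≡D v∈A w∈B)) refl
        ... | no v∉A  | _       = IsProduct-zero (dist v w) (π-zeroˡ v w v∉A) (term-zero v w (π-zeroˡ v w v∉A))
        ... | yes _   | no w∉B  = IsProduct-zero (dist v w) (π-zeroʳ v w w∉B) (term-zero v w (π-zeroʳ v w w∉B))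

      cost≤M : ∑ A (λ v → ∑ B (λ w → term v w)) ≤ M
      cost≤M = ≤-respˡ-≈ (sym (begin
        ∑ A (λ v → ∑ B (λ w → term v w))
          ≈⟨ ∑-cong A (λ _ → trans (∑-cong B (λ _ → sym (∑-*ˡ F _ _))) (∑-swap B F _)) ⟩
        ∑ A (λ v → ∑ F (λ (t , i , j) → ∑ B (λ w → fromNat (D v w) * (t * (𝟙 i (inj₁ v) * 𝟙 j (inj₂ w))))))
          ≈⟨ ∑-swap A F _ ⟩
        ∑ F (λ (t , i , j) → ∑ A (λ v → ∑ B (λ w → fromNat (D v w) * (t * (𝟙 i (inj₁ v) * 𝟙 j (inj₂ w))))))
          ≈⟨ ∑-cong F (λ t∈F → evaluate (edge t∈F)) ⟩
        ∑ F (λ (t , e) → t * ι (cost e)) ∎)) (proj₂ (proj₂ isFlow))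
        where
        evaluate : ∀ {t i j} → ∃[ a ] ∃[ b ] a ∈ A × b ∈ B × (i , j) ≡ (inj₁ a , inj₂ b) →
          ∑ A (λ v → ∑ B (λ w → fromNat (D v w) * (t * (𝟙 i (inj₁ v) * 𝟙 j (inj₂ w))))) ≈ t * ι (cost (i , j))
        evaluate {t} (a , b , a∈A , b∈B , ≡.refl) = begin
          ∑ A (λ v → ∑ B (λ w → fromNat (D v w) * (t * (𝟙 (inj₁ a) (inj₁ v) * 𝟙 (inj₂ b) (inj₂ w)))))
            ≈⟨ ∑-cong A (λ {v} _ → ∑-cong B (λ {w} _ →
                 solve 4 (λ d t x y → d :* (t :* (x :* y)) := ((t :* x) :* d) :* y) refl (fromNat (D v w)) t _ _)) ⟩
          ∑ A (λ v → ∑ B (λ w → ((t * 𝟙 (inj₁ a) (inj₁ v)) * fromNat (D v w)) * 𝟙 (inj₂ b) (inj₂ w)))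
            ≈⟨ ∑-cong A (λ {v} _ → ∑-𝟙-∈ inj₂ inj₂-injective (λ w → (t * 𝟙 (inj₁ a) (inj₁ v)) * fromNat (D v w)) uB b∈B) ⟩
          ∑ A (λ v → (t * 𝟙 (inj₁ a) (inj₁ v)) * fromNat (D v b))
            ≈⟨ ∑-cong A (λ {v} _ → solve 3 (λ d t x → (t :* x) :* d := (t :* d) :* x) refl (fromNat (D v b)) t _) ⟩
          ∑ A (λ v → (t * fromNat (D v b)) * 𝟙 (inj₁ a) (inj₁ v))
            ≈⟨ ∑-𝟙-∈ inj₁ inj₁-injective (λ v → t * fromNat (D v b)) uA a∈A ⟩
          t * fromNat (D a b) ∎

    strong-duality : ∀ M → IsUpperBound DualValue M → ∃[ c ] Cost c × c ≤ M
    strong-duality M bound = _ , (π , isCoupling , hasCost) , cost≤M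
      where
      flow : ∃ (IsFlow E net M)
      flow = duality E net M φ₀ φ₀-strict λ φ feas →
        bound _ ((φ ∘ inj₁) , (φ ∘ inj₂) , (λ a∈A b∈B → feas (∈-cartesianProductWith⁺ _ a∈A b∈B)) , ⟨net⟩ φ)
      open FromFlow M (proj₁ flow) (proj₂ flow)

    -- A bound on the dual values yields a coupling of finite cost through `strong-duality`, and the
    -- zero potentials bound all costs from below. Together they ensure that `inf` is a genuine
    -- infimum in `W₁`.
    W₁-isSupremum : ∃ (IsUpperBound DualValue) → IsSupremum DualValue (W₁ m₁ m₂)
    W₁-isSupremum (M₀ , bound₀) =
        (λ s (u , v , feas , eq) → ≤-respˡ-≈ (sym eq) (proj₂ isInf _ (λ c Cc → weak-duality {u} {v} feas Cc))) ,
        (λ M bound → let (c , Cc , c≤M) = strong-duality M bound in ≤-trans (proj₁ isInf c Cc) c≤M)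
      where
      isInf : IsInfimum Cost (W₁ m₁ m₂)
      isInf = inf-isInfimum Cost (let (c , Cc , _) = strong-duality M₀ bound₀ in c , Cc)
        (_ , λ c Cc → weak-duality {λ _ → 0ℤ} {λ _ → 0ℤ} (λ _ _ → +≤+ z≤n) Cc)

-- Paths and combinatorial distance.

module Distances (em : ExcludedMiddle 0ℓ) (R : CompleteOrderedField) (G : LocallyFiniteGraph) where

  open Curvature em R G

  dist⇒IsDistance : ∀ {v w n} → dist v w ≡ [ n ] → IsDistance v w n
  dist⇒IsDistance {v} {w} eq with em {∃ (IsDistance v w)}
  dist⇒IsDistance ≡.refl | yes (_ , isDistance) = isDistance
  dist⇒IsDistance ()     | no _

  -- Descent on the length: excluded middle either produces a strictly shorter path or certifies
  -- minimality.
  shortest : ∀ {v w} n → Path v w n → ∃ (IsDistance v w)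
  shortest {v} {w} = <-rec (λ n → Path v w n → ∃ (IsDistance v w)) step
    where
    step : ∀ n → (∀ {m} → m ℕ.< n → Path v w m → ∃ (IsDistance v w)) → Path v w n → ∃ (IsDistance v w)
    step n rec p with em {∃[ m ] m ℕ.< n × Path v w m}
    ... | yes (_ , m<n , q) = rec m<n q
    ... | no none = n , p , λ m q → ℕₚ.≮⇒≥ (λ m<n → none (m , m<n , q))

  κ-at : ∀ {x y n} → dist x y ≡ [ n ] → ∀ p → κ p x y ≡ 1# - W₁ (μ x p) (μ y p) * fromNat n ⁻¹
  κ-at {x} {y} eq p with dist x y
  κ-at ≡.refl p | [ n ] = ≡.refl
  κ-at ()     p | ⊤⁺

  -- The distance, with junk value 0 between different components.
  D : V → V → ℕ
  D v w with dist v w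
  ... | [ n ] = n
  ... | ⊤⁺    = 0

  path⇒dist : ∀ {v w n} → Path v w n → dist v w ≡ [ D v w ]
  path⇒dist {v} {w} {n} p with em {∃ (IsDistance v w)}
  ... | yes _   = ≡.refl
  ... | no none = ⊥-elim (none (shortest n p))

  dist⇒D : ∀ {v w n} → dist v w ≡ [ n ] → D v w ≡ n
  dist⇒D {v} {w} eq with dist v w
  dist⇒D ≡.refl | [ n ] = ≡.refl
  dist⇒D ()     | ⊤⁺

  D≤ : ∀ {v w n} → Path v w n → D v w ℕ.≤ n
  D≤ p = proj₂ (dist⇒IsDistance (path⇒dist p)) _ p

  geodesic : ∀ {v w n} → Path v w n → Path v w (D v w)
  geodesic p = proj₁ (dist⇒IsDistance (path⇒dist p))

  _++ᵖ_ : ∀ {u v w m n} → Path u v m → Path v w n → Path u w (m ℕ.+ n)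
  nil      ++ᵖ q = q
  cons e p ++ᵖ q = cons e (p ++ᵖ q)

maximum : ∀ {A : Set} (g : A → ℤ) {a l} → a ∈ l → ∃[ m ] m ∈ l × (∀ {b} → b ∈ l → g b ℤ.≤ g m)
maximum {A} g {l = c ∷ l} _ = go c l
  where
  go : ∀ c l → ∃[ m ] m ∈ c ∷ l × (∀ {b} → b ∈ c ∷ l → g b ℤ.≤ g m)
  go c [] = c , here ≡.refl , λ { (here ≡.refl) → ℤₚ.≤-refl }
  go c (b ∷ l) with go b l
  ... | m , m∈ , max with ℤₚ.≤-total (g c) (g m)
  ... | inj₁ c≤m = m , there m∈ , λ { (here ≡.refl) → c≤m ; (there b∈) → max b∈ }
  ... | inj₂ m≤c = c , here ≡.refl , λ { (here ≡.refl) → ℤₚ.≤-refl ; (there b∈) → ℤₚ.≤-trans (max b∈) m≤c }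

-- The measures `μ` and averages over neighbours.

module RandomWalk (em : ExcludedMiddle 0ℓ) (R : CompleteOrderedField) (G : LocallyFiniteGraph) where

  open Curvature em R G
  open OrderedField R
  open ListSums R
  open FiniteSupport em R
  open import Relation.Binary.Reasoning.Setoid setoid

  nbrs ball : V → List V
  nbrs v = proj₁ (locallyFinite v)
  ball v = v ∷ nbrs v

  nbr⇒~ : ∀ {v z} → z ∈ nbrs v → v ~ z
  nbr⇒~ {v} {z} = Equivalence.to (proj₂ (proj₂ (locallyFinite v)) z)

  ~⇒nbr : ∀ {v z} → v ~ z → z ∈ nbrs v
  ~⇒nbr {v} {z} = Equivalence.from (proj₂ (proj₂ (locallyFinite v)) z)

  nbr≢ : ∀ {v z} → z ∈ nbrs v → z ≢ v
  nbr≢ z∈ ≡.refl = ~-irrefl (nbr⇒~ z∈)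

  ball-unique : ∀ v → Unique (ball v)
  ball-unique v = All.tabulate (λ z∈ v≡z → nbr≢ z∈ (≡.sym v≡z)) ∷ proj₁ (proj₂ (locallyFinite v))

  μ-self : ∀ v p → μ v p v ≡ p
  μ-self v p with em {v ≡ v} | em {v ~ v}
  ... | yes _  | _ = ≡.refl
  ... | no v≢v | _ = ⊥-elim (v≢v ≡.refl)

  μ-nbr : ∀ v p {z} → z ∈ nbrs v → μ v p z ≡ (1# - p) * fromNat (degree v) ⁻¹
  μ-nbr v p {z} z∈ with em {z ≡ v} | em {z ~ v}
  ... | yes z≡v | _      = ⊥-elim (nbr≢ z∈ z≡v)
  ... | no _    | yes _  = ≡.refl
  ... | no _    | no z≁v = ⊥-elim (z≁v (~-sym (nbr⇒~ z∈)))

  μ-support : ∀ v p z → z ∉ ball v → μ v p z ≈ 0#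
  μ-support v p z z∉ with em {z ≡ v} | em {z ~ v}
  ... | yes z≡v | _       = ⊥-elim (z∉ (here z≡v))
  ... | no _    | yes z~v = ⊥-elim (z∉ (there (~⇒nbr (~-sym z~v))))
  ... | no _    | no _    = refl

  degree≉0 : ∀ {v z} → z ∈ nbrs v → ¬ fromNat (degree v) ≈ 0#
  degree≉0 {v} z∈ with nbrs v
  degree≉0 (here _)  | _ ∷ l = fromNat-suc≉0 (length l)
  degree≉0 (there _) | _ ∷ l = fromNat-suc≉0 (length l)

  1≤degree : ∀ {v z} → z ∈ nbrs v → 1# ≤ fromNat (degree v)
  1≤degree {v} z∈ with nbrs v
  1≤degree (here _)  | _ ∷ l = 1≤fromNat-suc (length l)
  1≤degree (there _) | _ ∷ l = 1≤fromNat-suc (length l)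

  μ≤1 : ∀ v {p} → p ∈[ 0# , 1# ] → ∀ z → μ v p z ≤ 1#
  μ≤1 v {p} (0≤p , p≤1) z with em {z ≡ v} | em {z ~ v}
  ... | yes _ | _       = p≤1
  ... | no _  | no _    = 0≤1
  ... | no _  | yes z~v = *-cancelˡ-≤ 0≤n n≉0 (≤-respˡ-≈ (sym n*≈)
        (≤-trans (≤-by 0≤p (solve 1 (λ p → con 1ℤ :- (con 1ℤ :- p) := p) refl p))
                 (≤-respʳ-≈ (sym (*-identityʳ _)) (1≤degree z∈))))
    where
    z∈ : z ∈ nbrs v
    z∈ = ~⇒nbr (~-sym z~v)
    n : Carrier
    n = fromNat (degree v)
    0≤n : 0# ≤ n
    0≤n = 0≤fromNat (degree v)
    n≉0 : ¬ n ≈ 0#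
    n≉0 = degree≉0 z∈
    n*≈ : n * ((1# - p) * n ⁻¹) ≈ 1# - p
    n*≈ = trans (*-comm _ _) (divide n≉0 (1# - p))

  average : V → (V → Carrier) → Carrier
  average v f = fromNat (degree v) ⁻¹ * ∑ (nbrs v) f

  -- Separating the centre from its neighbours shows that the integral of a fixed function is affine
  -- in p.
  μ-integral : ∀ v p f → ∑ (ball v) (λ z → μ v p z * f z) ≈ p * f v + (1# - p) * average v f
  μ-integral v p f = +-cong (*-congʳ (reflexive (μ-self v p))) (begin
    ∑ (nbrs v) (λ z → μ v p z * f z)                            ≈⟨ ∑-cong (nbrs v) (λ z∈ → *-congʳ (reflexive (μ-nbr v p z∈))) ⟩
    ∑ (nbrs v) (λ z → ((1# - p) * fromNat (degree v) ⁻¹) * f z) ≈⟨ ∑-*ˡ (nbrs v) _ f ⟩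
    ((1# - p) * fromNat (degree v) ⁻¹) * ∑ (nbrs v) f           ≈⟨ *-assoc _ _ _ ⟩
    (1# - p) * average v f                                      ∎)

  average-cong : ∀ v {f g} → (∀ {z} → z ∈ nbrs v → f z ≈ g z) → average v f ≈ average v g
  average-cong v f≈g = *-congˡ (∑-cong (nbrs v) f≈g)

  average-const : ∀ {v z} → z ∈ nbrs v → ∀ k → average v (λ _ → k) ≈ k
  average-const {v} z∈ k = begin
    n ⁻¹ * ∑ (nbrs v) (λ _ → k)  ≈⟨ *-congˡ (∑-const (nbrs v) k) ⟩
    n ⁻¹ * (n * k)               ≈⟨ solve 3 (λ i n k → i :* (n :* k) := (k :* i) :* n) refl (n ⁻¹) n k ⟩
    (k * n ⁻¹) * n               ≈⟨ divide (degree≉0 z∈) k ⟩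
    k                            ∎
    where
    n = fromNat (degree v)

  average-≤ : ∀ {v z f k} → z ∈ nbrs v → (∀ {w} → w ∈ nbrs v → f w ≤ k) → average v f ≤ k
  average-≤ {v} z∈ f≤k = ≤-respʳ-≈ (average-const z∈ _)
    (*-monoˡ-≤ (0≤⁻¹ (0≤fromNat (degree v)) (degree≉0 z∈)) (∑-mono (nbrs v) f≤k))

  average-≥ : ∀ {v z f k} → z ∈ nbrs v → (∀ {w} → w ∈ nbrs v → k ≤ f w) → k ≤ average v f
  average-≥ {v} z∈ k≤f = ≤-respˡ-≈ (average-const z∈ _)
    (*-monoˡ-≤ (0≤⁻¹ (0≤fromNat (degree v)) (degree≉0 z∈)) (∑-mono (nbrs v) k≤f))

  _[_≔_] : (V → ℤ) → V → ℤ → V → ℤ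
  (u [ v ≔ i ]) w with em {w ≡ v}
  ... | yes _ = i
  ... | no _  = u w

  ≔-at : ∀ u v i → (u [ v ≔ i ]) v ≡ i
  ≔-at u v i with em {v ≡ v}
  ... | yes _  = ≡.refl
  ... | no v≢v = ⊥-elim (v≢v ≡.refl)

  ≔-nbr : ∀ u v i {z} → z ∈ nbrs v → (u [ v ≔ i ]) z ≡ u z
  ≔-nbr u v i {z} z∈ with em {z ≡ v}
  ... | yes z≡v = ⊥-elim (nbr≢ z∈ z≡v)
  ... | no _    = ≡.refl

  -- There are no loops, so the average over the neighbours of v does not see the value at v. The
  -- values of the potentials at x and y can thus be changed without changing the gain.
  average-≔ : ∀ u v i → average v (ι ∘ (u [ v ≔ i ])) ≈ average v (ι ∘ u)
  average-≔ u v i = average-cong v λ z∈ → reflexive (≡.cong ι (≔-nbr u v i z∈))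

-- Upper envelopes of three pairwise crossing lines.

module Envelope (R : CompleteOrderedField) where

  open CompleteOrderedField R
  open OrderedField R

  CrossesAt : Carrier → (l l′ : Carrier → Carrier) → Set
  CrossesAt c l l′ = c ∈[ 0# , 1# ] × (∀ p → p ≤ c → l′ p ≤ l p) × (∀ p → c ≤ p → l p ≤ l′ p)

  -- Expresses that f is governed by the upper envelope of the lines without naming their maximum:
  -- `κ` will be 1 - max / δ.
  AffineWhereMaximal : (f l₀ l₁ l₂ l : Carrier → Carrier) → Set
  AffineWhereMaximal f l₀ l₁ l₂ l = ∀ {a b} → 0# ≤ a → b ≤ 1# →
    (∀ p → p ∈[ a , b ] → l₀ p ≤ l p × l₁ p ≤ l p × l₂ p ≤ l p) → AffineOn a b f

  -- If `l₁` overtakes `l₀` before `l₂` overtakes `l₁`, the three lines are on top in this order.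
  -- Otherwise `l₁` can be skipped.
  envelope-piecewiseLinear : ∀ {f l₀ l₁ l₂ c₀₁ c₁₂ c₀₂} →
    CrossesAt c₀₁ l₀ l₁ → CrossesAt c₁₂ l₁ l₂ → CrossesAt c₀₂ l₀ l₂ →
    AffineWhereMaximal f l₀ l₁ l₂ l₀ → AffineWhereMaximal f l₀ l₁ l₂ l₁ → AffineWhereMaximal f l₀ l₁ l₂ l₂ →
    PiecewiseLinearOn[0,1] 3 f
  envelope-piecewiseLinear {f} {l₀} {l₁} {l₂} {c₀₁} {c₁₂} {c₀₂}
    ((0≤c₀₁ , c₀₁≤1) , below₀₁ , above₀₁) ((0≤c₁₂ , c₁₂≤1) , below₁₂ , above₁₂) ((0≤c₀₂ , c₀₂≤1) , below₀₂ , above₀₂)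
    affine₀ affine₁ affine₂ with total c₀₁ c₁₂
  ... | inj₁ c₀₁≤c₁₂ = t , refl , refl , pieces
    where
    t : Fin 4 → Carrier
    t Fin.zero                               = 0#
    t (Fin.suc Fin.zero)                     = c₀₁
    t (Fin.suc (Fin.suc Fin.zero))           = c₁₂
    t (Fin.suc (Fin.suc (Fin.suc Fin.zero))) = 1#
    pieces : ∀ (i : Fin 3) → t (Fin.inject₁ i) ≤ t (Fin.suc i) × AffineOn (t (Fin.inject₁ i)) (t (Fin.suc i)) f
    pieces Fin.zero = 0≤c₀₁ , affine₀ ≤-refl c₀₁≤1 λ p (_ , p≤) →
      ≤-refl , below₀₁ p p≤ , ≤-trans (below₁₂ p (≤-trans p≤ c₀₁≤c₁₂)) (below₀₁ p p≤)
    pieces (Fin.suc Fin.zero) = c₀₁≤c₁₂ , affine₁ 0≤c₀₁ c₁₂≤1 λ p (≤p , p≤) →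
      above₀₁ p ≤p , ≤-refl , below₁₂ p p≤
    pieces (Fin.suc (Fin.suc Fin.zero)) = c₁₂≤1 , affine₂ 0≤c₁₂ ≤-refl λ p (≤p , _) →
      ≤-trans (above₀₁ p (≤-trans c₀₁≤c₁₂ ≤p)) (above₁₂ p ≤p) , above₁₂ p ≤p , ≤-refl
  ... | inj₂ c₁₂≤c₀₁ = t , refl , refl , pieces
    where
    t : Fin 4 → Carrier
    t Fin.zero                               = 0#
    -- The middle line is nowhere strictly on top, so `l₀` hands over to `l₂` directly. The repeated
    -- breakpoint shrinks the middle interval to a point.
    t (Fin.suc Fin.zero)                     = c₀₂
    t (Fin.suc (Fin.suc Fin.zero))           = c₀₂
    t (Fin.suc (Fin.suc (Fin.suc Fin.zero))) = 1#
    left : ∀ p → p ≤ c₀₂ → l₀ p ≤ l₀ p × l₁ p ≤ l₀ p × l₂ p ≤ l₀ p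
    left p p≤ with total p c₀₁
    ... | inj₁ p≤c₀₁ = ≤-refl , below₀₁ p p≤c₀₁ , below₀₂ p p≤
    ... | inj₂ c₀₁≤p = ≤-refl , ≤-trans (above₁₂ p (≤-trans c₁₂≤c₀₁ c₀₁≤p)) (below₀₂ p p≤) , below₀₂ p p≤
    right : ∀ p → c₀₂ ≤ p → l₀ p ≤ l₂ p × l₁ p ≤ l₂ p × l₂ p ≤ l₂ p
    right p ≤p with total p c₁₂
    ... | inj₁ p≤c₁₂ = above₀₂ p ≤p , ≤-trans (below₀₁ p (≤-trans p≤c₁₂ c₁₂≤c₀₁)) (above₀₂ p ≤p) , ≤-refl
    ... | inj₂ c₁₂≤p = above₀₂ p ≤p , above₁₂ p c₁₂≤p , ≤-refl
    pieces : ∀ (i : Fin 3) → t (Fin.inject₁ i) ≤ t (Fin.suc i) × AffineOn (t (Fin.inject₁ i)) (t (Fin.suc i)) f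
    pieces Fin.zero = 0≤c₀₂ , affine₀ ≤-refl c₀₂≤1 λ p (_ , p≤) → left p p≤
    pieces (Fin.suc Fin.zero) = ≤-refl , affine₀ 0≤c₀₂ c₀₂≤1 λ p (_ , p≤) → left p p≤
    pieces (Fin.suc (Fin.suc Fin.zero)) = c₀₂≤1 , affine₂ 0≤c₀₂ ≤-refl λ p (≤p , _) → right p ≤p

-- Curvature as a function of p for vertices at distance at least 2.

module Idleness (em : ExcludedMiddle 0ℓ) (R : CompleteOrderedField) (G : LocallyFiniteGraph) where

  open Curvature em R G
  open OrderedField R
  open ListSums R
  open Distances em R G
  open RandomWalk em R G
  open Kantorovich em R G
  open import Relation.Binary.Reasoning.Setoid setoid
  open import Algebra.Properties.Semiring.Mult semiring using (×-homo-+)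

  module FarApart (x y : V) (d : ℕ) (dist-xy : dist x y ≡ [ suc (suc d) ]) where

    δ : ℕ
    δ = suc (suc d)

    xy-path : Path x y δ
    xy-path = proj₁ (dist⇒IsDistance dist-xy)

    D-xy : D x y ≡ δ
    D-xy = dist⇒D dist-xy

    x-nbr : ∃[ z ] z ∈ nbrs x
    x-nbr = first xy-path
      where
      first : ∀ {v w n} → Path v w (suc n) → ∃[ z ] z ∈ nbrs v
      first (cons e _) = _ , ~⇒nbr e

    y-nbr : ∃[ z ] z ∈ nbrs y
    y-nbr = last xy-path
      where
      last : ∀ {v w n} → Path v w (suc n) → ∃[ z ] z ∈ nbrs w
      last (cons e nil)             = _ , ~⇒nbr (~-sym e)
      last (cons _ p@(cons _ _))    = last p

    from-y : ∀ {b} → b ∈ ball y → ∃ (Path y b)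
    from-y (here ≡.refl) = 0 , nil
    from-y (there b∈)    = 1 , cons (nbr⇒~ b∈) nil

    connected : ∀ {a b} → a ∈ ball x → b ∈ ball y → ∃ (Path a b)
    connected (here ≡.refl) b∈ = _ , xy-path ++ᵖ proj₂ (from-y b∈)
    connected (there a∈)    b∈ = _ , cons (~-sym (nbr⇒~ a∈)) (xy-path ++ᵖ proj₂ (from-y b∈))

    δ≤1+D : ∀ {a} → a ∈ nbrs x → δ ℕ.≤ suc (D a y)
    δ≤1+D a∈ = proj₂ (dist⇒IsDistance dist-xy) _
      (cons (nbr⇒~ a∈) (geodesic (proj₂ (connected (there a∈) (here ≡.refl)))))

    D≤1+D : ∀ {a b} → a ∈ nbrs x → b ∈ nbrs y → D a b ℕ.≤ suc (D x b)
    D≤1+D a∈ b∈ = D≤ (cons (~-sym (nbr⇒~ a∈)) (geodesic (proj₂ (connected (here ≡.refl) (there b∈)))))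

    D≤2+δ : ∀ {a b} → a ∈ nbrs x → b ∈ nbrs y → D a b ℕ.≤ suc (δ ℕ.+ 1)
    D≤2+δ a∈ b∈ = D≤ (cons (~-sym (nbr⇒~ a∈)) (xy-path ++ᵖ cons (nbr⇒~ b∈) nil))

    Feasible : (u v : V → ℤ) → Set
    Feasible u v = ∀ {a b} → a ∈ ball x → b ∈ ball y → u a ℤ.≤ v b ℤ.+ ℤ.+ D a b

    -- The coefficient of 1 - p in the dual value; it is independent of u(x) and v(y).
    gain : (u v : V → ℤ) → Carrier
    gain u v = average x (ι ∘ u) - average y (ι ∘ v)

    -- With a potential difference of at least k rather than exactly k, the best
    -- gain is antitone in k, so that any two of the lines below cross in [0,1].
    Gain : ℕ → Carrier → Set
    Gain k s = ∃[ u ] ∃[ v ] Feasible u v × v y ℤ.+ ℤ.+ k ℤ.≤ u x × s ≈ gain u v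

    ≔-feasible : ∀ u v {X Y} →
      X ℤ.≤ Y ℤ.+ ℤ.+ δ →
      (∀ {b} → b ∈ nbrs y → X ℤ.≤ v b ℤ.+ ℤ.+ D x b) →
      (∀ {a} → a ∈ nbrs x → u a ℤ.≤ Y ℤ.+ ℤ.+ D a y) →
      (∀ {a b} → a ∈ nbrs x → b ∈ nbrs y → u a ℤ.≤ v b ℤ.+ ℤ.+ D a b) →
      Feasible (u [ x ≔ X ]) (v [ y ≔ Y ])
    ≔-feasible u v {X} {Y} xy xb ay ab (here ≡.refl) (here ≡.refl)
      rewrite ≔-at u x X | ≔-at v y Y | D-xy = xy
    ≔-feasible u v {X} {Y} xy xb ay ab (here ≡.refl) (there b∈)
      rewrite ≔-at u x X | ≔-nbr v y Y b∈ = xb b∈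
    ≔-feasible u v {X} {Y} xy xb ay ab (there a∈) (here ≡.refl)
      rewrite ≔-nbr u x X a∈ | ≔-at v y Y = ay a∈
    ≔-feasible u v {X} {Y} xy xb ay ab (there a∈) (there b∈)
      rewrite ≔-nbr u x X a∈ | ≔-nbr v y Y b∈ = ab a∈ b∈

    ≔-gain : ∀ u v X Y → gain (u [ x ≔ X ]) (v [ y ≔ Y ]) ≈ gain u v
    ≔-gain u v X Y = +-cong (average-≔ u x X) (-‿cong (average-≔ v y Y))

    -- Take u to be δ at x and 0 elsewhere, and v to be 0 at y and δ elsewhere. With `Gain-antitone`
    -- this makes `Gain k` inhabited for all k ≤ δ.
    Gain-δ : ∃ (Gain δ)
    Gain-δ = _ , u , v , ≔-feasible (λ _ → 0ℤ) (λ _ → ℤ.+ δ)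
        (ℤₚ.≤-reflexive (≡.sym (ℤₚ.+-identityˡ _)))
        (λ {b} _ → ℤₚ.i≤i+j (ℤ.+ δ) (ℤ.+ D x b)) (λ _ → +≤+ z≤n) (λ _ _ → +≤+ z≤n) ,
      ℤₚ.≤-reflexive (≡.trans (≡.cong (ℤ._+ ℤ.+ δ) (≔-at _ y 0ℤ)) (≡.sym (≔-at _ x (ℤ.+ δ)))) , refl
      where
      u v : V → ℤ
      u = (λ _ → 0ℤ) [ x ≔ ℤ.+ δ ]
      v = (λ _ → ℤ.+ δ) [ y ≔ 0ℤ ]

    Gain-antitone : ∀ {j k s} → j ℕ.≤ k → Gain k s → Gain j s
    Gain-antitone j≤k (u , v , feas , k≤ , eq) =
      u , v , feas , ℤₚ.≤-trans (ℤₚ.+-monoʳ-≤ (v y) (+≤+ j≤k)) k≤ , eq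

    -- For neighbours a of x and b of y, u(a) - v(b) ≤ d(a,b) ≤ δ + 2, and averaging preserves the
    -- bound.
    Gain-bounded : ∀ k → IsUpperBound (Gain k) (fromNat (suc (δ ℕ.+ 1)))
    Gain-bounded k s (u , v , feas , _ , eq) = ≤-respˡ-≈ (sym eq)
      (≤-by (≤⇒0≤- (average-≤ (proj₂ x-nbr) λ {a} a∈ →
          ≤-by (≤⇒0≤- (average-≥ (proj₂ y-nbr) λ {b} b∈ → ua-K≤vb a∈ b∈))
            (solve 3 (λ u K v → (v :+ K) :- u := v :- (u :- K)) refl (ι (u a)) K _)))
        (solve 3 (λ u K v → K :- (u :- v) := (v :+ K) :- u) refl _ K _))
      where
      K : Carrier
      K = fromNat (suc (δ ℕ.+ 1))
      ua-K≤vb : ∀ {a b} → a ∈ nbrs x → b ∈ nbrs y → ι (u a) - K ≤ ι (v b)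
      ua-K≤vb {a} {b} a∈ b∈ = ≤-by (≤⇒0≤- (≤-respʳ-≈ (ι-+ (v b) (ℤ.+ suc (δ ℕ.+ 1)))
          (ι-mono-≤ (ℤₚ.≤-trans (feas (there a∈) (there b∈)) (ℤₚ.+-monoʳ-≤ (v b) (+≤+ (D≤2+δ a∈ b∈)))))))
        (solve 3 (λ u K v → v :- (u :- K) := (v :+ K) :- u) refl (ι (u a)) K (ι (v b)))

    -- The step using δ ≥ 2: the values at the neighbours of x and of y always
    -- admit values at x and y with difference δ − 2.
    Gain-d : ∀ u v → Feasible u v → Gain d (gain u v)
    Gain-d u v feas =
        u [ x ≔ X ] , v [ y ≔ Y ] ,
        ≔-feasible u v (ℤₚ.+-monoʳ-≤ Y (+≤+ (ℕₚ.m≤n+m d 2))) X≤ ≤Y (λ a∈ b∈ → feas (there a∈) (there b∈)) ,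
        ℤₚ.≤-reflexive (≡.trans (≡.cong (ℤ._+ ℤ.+ d) (≔-at v y Y)) (≡.sym (≔-at u x X))) ,
        sym (≔-gain u v X Y)
      where
      max : ∃[ m ] m ∈ nbrs x × (∀ {a} → a ∈ nbrs x → u a ℤ.- ℤ.+ D a y ℤ.≤ u m ℤ.- ℤ.+ D m y)
      max = maximum (λ a → u a ℤ.- ℤ.+ D a y) (proj₂ x-nbr)
      m : V
      m = proj₁ max
      m∈ : m ∈ nbrs x
      m∈ = proj₁ (proj₂ max)
      -- `Y` is the least value at y that the neighbours of x allow, attained at the neighbour `m`.
      -- The value `X` then forces the difference to be exactly d = δ - 2.
      Y X : ℤ
      Y = u m ℤ.- ℤ.+ D m y
      X = Y ℤ.+ ℤ.+ d
      ≤Y : ∀ {a} → a ∈ nbrs x → u a ℤ.≤ Y ℤ.+ ℤ.+ D a y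
      ≤Y {a} a∈ = ≤-byℤ (ℤₚ.i≤j⇒0≤j-i (proj₂ (proj₂ max) a∈)) (identity Y (u a) (ℤ.+ D a y))
        where
        identity : ∀ Y u D → (Y ℤ.+ D) ℤ.- u ≡ Y ℤ.- (u ℤ.- D)
        identity = solve-∀
      -- From m to b is at most one step longer than from x to b, while m is at distance at least d
      -- + 1 from y. The two units cancel.
      X≤ : ∀ {b} → b ∈ nbrs y → X ℤ.≤ v b ℤ.+ ℤ.+ D x b
      X≤ {b} b∈ = ≤-byℤ (0≤+ℤ (0≤+ℤ
            (ℤₚ.i≤j⇒0≤j-i (feas (there m∈) (there b∈)))
            (ℤₚ.i≤j⇒0≤j-i (+≤+ (D≤1+D m∈ b∈))))
            (ℤₚ.i≤j⇒0≤j-i (+≤+ (ℕ.s≤s⁻¹ (δ≤1+D m∈)))))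
          (identity (u m) (v b) (ℤ.+ D m b) (ℤ.+ D x b) (ℤ.+ D m y) (ℤ.+ d))
        where
        identity : ∀ u v Dmb Dxb Dmy d → (v ℤ.+ Dxb) ℤ.- ((u ℤ.- Dmy) ℤ.+ d)
          ≡ (((v ℤ.+ Dmb) ℤ.- u) ℤ.+ ((1ℤ ℤ.+ Dxb) ℤ.- Dmb)) ℤ.+ (Dmy ℤ.- (1ℤ ℤ.+ d))
        identity = solve-∀

    abstract
      bestGain : ∀ k → k ℕ.≤ δ → ∃ (IsSupremum (Gain k))
      bestGain k k≤δ = supremum (Gain k) (_ , Gain-antitone k≤δ (proj₂ Gain-δ)) (_ , Gain-bounded k)

    module Line (k : ℕ) (k≤δ : k ℕ.≤ δ) where

      F : Carrier
      F = proj₁ (bestGain k k≤δ)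

      gain≤F : IsUpperBound (Gain k) F
      gain≤F = proj₁ (proj₂ (bestGain k k≤δ))

      F-least : ∀ a → IsUpperBound (Gain k) a → F ≤ a
      F-least = proj₂ (proj₂ (bestGain k k≤δ))

      line : Carrier → Carrier
      line p = p * fromNat k + (1# - p) * F

    module L₀ = Line d (ℕₚ.m≤n+m d 2)
    module L₁ = Line (suc d) (ℕₚ.n≤1+n (suc d))
    module L₂ = Line δ ℕₚ.≤-refl

    W : Carrier → Carrier
    W p = W₁ (μ x p) (μ y p)

    module At (p : Carrier) (p∈[0,1] : p ∈[ 0# , 1# ]) where

      open OnSupports (ball x) (ball y) (ball-unique x) (ball-unique y)
        D (λ a∈ b∈ → path⇒dist (proj₂ (connected a∈ b∈)))
        (μ x p) (μ y p) (μ≤1 x p∈[0,1]) (μ-support x p) (μ-support y p)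
        using (dual; DualValue; W₁-isSupremum)

      0≤1-p : 0# ≤ 1# - p
      0≤1-p = ≤⇒0≤- (proj₂ p∈[0,1])

      dual≈ : ∀ u v → dual u v ≈ p * (ι (u x) - ι (v y)) + (1# - p) * gain u v
      dual≈ u v = trans (+-cong (μ-integral x p (ι ∘ u)) (-‿cong (μ-integral y p (ι ∘ v))))
        (solve 6 (λ p q a b s t → (p :* a :+ q :* s) :- (p :* b :+ q :* t) := p :* (a :- b) :+ q :* (s :- t))
               refl p (1# - p) (ι (u x)) (ι (v y)) _ _)

      -- The two summands of the dual value are bounded separately, so the potentials inside the
      -- `Gain` witness may differ from u and v. This lets `Gain-d` handle all differences up to δ -
      -- 2.
      dual≤line : ∀ k k≤δ u v → Gain k (gain u v) → u x ℤ.≤ v y ℤ.+ ℤ.+ k → dual u v ≤ Line.line k k≤δ p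
      dual≤line k k≤δ u v g u≤ = ≤-respˡ-≈ (sym (dual≈ u v)) (+-mono-≤
        (*-monoˡ-≤ (proj₁ p∈[0,1]) (≤-by (≤⇒0≤- (≤-respʳ-≈ (ι-+ (v y) (ℤ.+ k)) (ι-mono-≤ u≤)))
          (solve 3 (λ a b k → k :- (a :- b) := (b :+ k) :- a) refl (ι (u x)) (ι (v y)) (fromNat k))))
        (*-monoˡ-≤ 0≤1-p (Line.gain≤F k k≤δ _ g)))

      -- Feasibility at (x, y) gives u(x) - v(y) ≤ δ. The difference is therefore δ, δ - 1 or at
      -- most δ - 2, one case for each line.
      lines-bound : ∀ {M} → L₀.line p ≤ M → L₁.line p ≤ M → L₂.line p ≤ M → IsUpperBound DualValue M
      lines-bound {M} h₀ h₁ h₂ s (u , v , feas , eq) = ≤-respˡ-≈ (sym eq) dual≤M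
        where
        -- Integrality enters here: a difference below k + 1 is at most k.
        lower : ∀ {k} → ¬ v y ℤ.+ ℤ.+ suc k ℤ.≤ u x → u x ℤ.≤ v y ℤ.+ ℤ.+ k
        lower {k} h = ≤-byℤ (ℤₚ.i≤j⇒0≤j-i (ℤₚ.i<j⇒suc[i]≤j (ℤₚ.≰⇒> h))) (shift (u x) (v y) (ℤ.+ k))
          where
          shift : ∀ a b k → (b ℤ.+ k) ℤ.- a ≡ (b ℤ.+ (1ℤ ℤ.+ k)) ℤ.- (1ℤ ℤ.+ a)
          shift = solve-∀
        dual≤M : dual u v ≤ M
        dual≤M with em {v y ℤ.+ ℤ.+ δ ℤ.≤ u x} | em {v y ℤ.+ ℤ.+ suc d ℤ.≤ u x}
        ... | yes δ≤ | _ = ≤-trans (dual≤line δ ℕₚ.≤-refl u v (u , v , feas , δ≤ , refl)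
              (≡.subst (λ n → u x ℤ.≤ v y ℤ.+ ℤ.+ n) D-xy (feas (here ≡.refl) (here ≡.refl)))) h₂
        ... | no δ≰ | yes 1+d≤ = ≤-trans (dual≤line (suc d) (ℕₚ.n≤1+n (suc d)) u v (u , v , feas , 1+d≤ , refl) (lower δ≰)) h₁
        ... | no _  | no 1+d≰  = ≤-trans (dual≤line d (ℕₚ.m≤n+m d 2) u v (Gain-d u v feas) (lower 1+d≰)) h₀

      bounded : ∃ (IsUpperBound DualValue)
      bounded with maximum₃ (L₀.line p) (L₁.line p) (L₂.line p)
      ... | M , h₀ , h₁ , h₂ = M , lines-bound h₀ h₁ h₂

      W≤ : ∀ {M} → L₀.line p ≤ M → L₁.line p ≤ M → L₂.line p ≤ M → W p ≤ M
      W≤ h₀ h₁ h₂ = proj₂ (W₁-isSupremum bounded) _ (lines-bound h₀ h₁ h₂)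

      -- Potentials of difference at least k and gain s have dual value at least p k + (1 - p) s,
      -- since p ≥ 0. It remains to pass to the supremum over s.
      line≤W : ∀ k k≤δ → Line.line k k≤δ p ≤ W p
      line≤W k k≤δ = ≤-by (≤⇒0≤- scaled) (solve 3 (λ W a b → W :- (a :+ b) := (W :- a) :- b) refl (W p) _ _)
        where
        below : ∀ s → Gain k s → (1# - p) * s ≤ W p - p * fromNat k
        below s (u , v , feas , k≤ , eq) = ≤-by
          (0≤+ (≤⇒0≤- (proj₁ (W₁-isSupremum bounded) _ (u , v , feas , refl)))
               (≤⇒0≤- (*-monoˡ-≤ (proj₁ p∈[0,1]) (≤-respˡ-≈ (ι-+ (v y) (ℤ.+ k)) (ι-mono-≤ k≤)))))
          (begin
            (W p - p * fromNat k) - (1# - p) * s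
              ≈⟨ solve 6 (λ W p k s a b → (W :- p :* k) :- (con 1ℤ :- p) :* s
                   := (W :- (p :* (a :- b) :+ (con 1ℤ :- p) :* s)) :+ (p :* a :- p :* (b :+ k))) refl (W p) p (fromNat k) s (ι (u x)) (ι (v y)) ⟩
            (W p - (p * (ι (u x) - ι (v y)) + (1# - p) * s)) + (p * ι (u x) - p * (ι (v y) + fromNat k))
              ≈⟨ +-congʳ (+-congˡ (-‿cong (trans (+-congˡ (*-congˡ eq)) (sym (dual≈ u v))))) ⟩
            (W p - dual u v) + (p * ι (u x) - p * (ι (v y) + fromNat k)) ∎)
        scaled : (1# - p) * Line.F k k≤δ ≤ W p - p * fromNat k
        scaled with em {1# - p ≈ 0#}
        ... | no 1-p≉0  = *-supremum-≤ 0≤1-p 1-p≉0 (proj₂ (bestGain k k≤δ)) below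
        -- At p = 1 the factor cannot be cancelled, but then the gain has weight 0 and any element
        -- of `Gain k` gives the inequality.
        ... | yes 1-p≈0 = ≤-respˡ-≈ (trans (*-congʳ 1-p≈0) (trans (zeroˡ _) (sym (trans (*-congʳ 1-p≈0) (zeroˡ _)))))
          (below _ (Gain-antitone k≤δ (proj₂ Gain-δ)))

    -- The upper line minus the lower is p (m + 1) - (1 - p) (F - F′), where F ≥ F′ because `Gain`
    -- is antitone; `single-crossing` applies.
    crossing : ∀ k m k≤δ m+k≤δ → ∃[ c ] c ∈[ 0# , 1# ] ×
      (∀ p → p ≤ c → Line.line (suc m ℕ.+ k) m+k≤δ p ≤ Line.line k k≤δ p) ×
      (∀ p → c ≤ p → Line.line k k≤δ p ≤ Line.line (suc m ℕ.+ k) m+k≤δ p)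
    crossing k m k≤δ m+k≤δ =
      let c , c∈ , below , above = single-crossing (fromNat (suc m)) (K.F - K′.F) (0≤fromNat (suc m)) (fromNat-suc≉0 m) 0≤h
      in c , c∈ ,
        (λ p p≤c → ≤-by (≤⇒0≤- (below p p≤c)) (difference p (fromNat k) (fromNat (suc m)) K.F K′.F (split p))) ,
        (λ p c≤p → ≤-by (≤⇒0≤- (above p c≤p)) (difference′ p (fromNat k) (fromNat (suc m)) K.F K′.F (split p)))
      where
      module K = Line k k≤δ
      module K′ = Line (suc m ℕ.+ k) m+k≤δ
      0≤h : 0# ≤ K.F - K′.F
      0≤h = ≤⇒0≤- (K′.F-least _ λ s Gs → K.gain≤F s (Gain-antitone (ℕₚ.m≤n+m k (suc m)) Gs))
      split : ∀ p → K′.line p ≈ p * (fromNat (suc m) + fromNat k) + (1# - p) * K′.F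
      split p = +-congʳ (*-congˡ (×-homo-+ 1# (suc m) k))
      difference : ∀ p k g F F′ {l} → l ≈ p * (g + k) + (1# - p) * F′ →
        (p * k + (1# - p) * F) - l ≈ (1# - p) * (F - F′) - p * g
      difference p k g F F′ eq = trans (+-congˡ (-‿cong eq))
        (solve 5 (λ p k g F F′ → (p :* k :+ (con 1ℤ :- p) :* F) :- (p :* (g :+ k) :+ (con 1ℤ :- p) :* F′)
            := (con 1ℤ :- p) :* (F :- F′) :- p :* g) refl p k g F F′)
      difference′ : ∀ p k g F F′ {l} → l ≈ p * (g + k) + (1# - p) * F′ →
        l - (p * k + (1# - p) * F) ≈ p * g - (1# - p) * (F - F′)
      difference′ p k g F F′ eq = trans (+-congʳ eq)
        (solve 5 (λ p k g F F′ → (p :* (g :+ k) :+ (con 1ℤ :- p) :* F′) :- (p :* k :+ (con 1ℤ :- p) :* F)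
            := p :* g :- (con 1ℤ :- p) :* (F :- F′)) refl p k g F F′)

    δ⁻¹ : Carrier
    δ⁻¹ = fromNat δ ⁻¹

    0≤δ⁻¹ : 0# ≤ δ⁻¹
    0≤δ⁻¹ = 0≤⁻¹ (0≤fromNat δ) (fromNat-suc≉0 (suc d))

    κ≡ : ∀ p → κ p x y ≡ 1# - W p * δ⁻¹
    κ≡ = κ-at dist-xy

    -- Each line lies below `W` at p and at q, so at the intermediate point `r` it lies below the
    -- chord of `W`. As `W r` is at most any common bound of the three lines, `W` is convex, and `κ`
    -- is 1 - `W` / δ.
    concave : ConcaveOn[0,1] (λ p → κ p x y)
    concave p q t p∈ q∈ t∈ = ≤-respˡ-≈ (reflexive (≡.sym (≡.cong₂ (λ a b → t * a + (1# - t) * b) (κ≡ p) (κ≡ q))))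
      (≤-respʳ-≈ (reflexive (≡.sym (κ≡ r))) (≤-by (*-nonNeg 0≤δ⁻¹ (≤⇒0≤- (At.W≤ r r∈ (chord d (ℕₚ.m≤n+m d 2)) (chord (suc d) (ℕₚ.n≤1+n (suc d))) (chord δ ℕₚ.≤-refl))))
        (solve 5 (λ t a b c i → (con 1ℤ :- c :* i) :- (t :* (con 1ℤ :- a :* i) :+ (con 1ℤ :- t) :* (con 1ℤ :- b :* i))
            := i :* ((t :* a :+ (con 1ℤ :- t) :* b) :- c)) refl t (W p) (W q) (W r) δ⁻¹)))
      where
      r : Carrier
      r = t * p + (1# - t) * q
      0≤1-t : 0# ≤ 1# - t
      0≤1-t = ≤⇒0≤- (proj₂ t∈)
      r∈ : r ∈[ 0# , 1# ]
      r∈ = 0≤+ (*-nonNeg (proj₁ t∈) (proj₁ p∈)) (*-nonNeg 0≤1-t (proj₁ q∈)) ,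
        ≤-by (0≤+ (*-nonNeg (proj₁ t∈) (≤⇒0≤- (proj₂ p∈))) (*-nonNeg 0≤1-t (≤⇒0≤- (proj₂ q∈))))
          (solve 3 (λ t p q → con 1ℤ :- (t :* p :+ (con 1ℤ :- t) :* q) := t :* (con 1ℤ :- p) :+ (con 1ℤ :- t) :* (con 1ℤ :- q)) refl t p q)
      chord : ∀ k k≤δ → Line.line k k≤δ r ≤ t * W p + (1# - t) * W q
      chord k k≤δ = ≤-respˡ-≈
        (solve 5 (λ t p q k F → t :* (p :* k :+ (con 1ℤ :- p) :* F) :+ (con 1ℤ :- t) :* (q :* k :+ (con 1ℤ :- q) :* F)
            := (t :* p :+ (con 1ℤ :- t) :* q) :* k :+ (con 1ℤ :- (t :* p :+ (con 1ℤ :- t) :* q)) :* F)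
          refl t p q (fromNat k) (Line.F k k≤δ))
        (+-mono-≤ (*-monoˡ-≤ (proj₁ t∈) (At.line≤W p p∈ k k≤δ)) (*-monoˡ-≤ 0≤1-t (At.line≤W q q∈ k k≤δ)))

    -- Where one line dominates the others, `W≤` and `line≤W` together identify `W` with it.
    affine : ∀ k k≤δ {a b} → 0# ≤ a → b ≤ 1# →
      (∀ p → p ∈[ a , b ] → L₀.line p ≤ Line.line k k≤δ p × L₁.line p ≤ Line.line k k≤δ p × L₂.line p ≤ Line.line k k≤δ p) →
      AffineOn a b (λ p → κ p x y)
    affine k k≤δ 0≤a b≤1 top = - ((fromNat k - F) * δ⁻¹) , 1# - F * δ⁻¹ , λ p p∈@(a≤p , p≤b) →
      let p∈[0,1] = ≤-trans 0≤a a≤p , ≤-trans p≤b b≤1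
          h₀ , h₁ , h₂ = top p p∈
          W≈ = ≤-antisym (At.W≤ p p∈[0,1] h₀ h₁ h₂) (At.line≤W p p∈[0,1] k k≤δ)
      in trans (reflexive (κ≡ p)) (trans (+-congˡ (-‿cong (*-congʳ W≈)))
        (solve 4 (λ p k F i → con 1ℤ :- (p :* k :+ (con 1ℤ :- p) :* F) :* i
            := (:- ((k :- F) :* i)) :* p :+ (con 1ℤ :- F :* i)) refl p (fromNat k) F δ⁻¹))
      where open Line k k≤δ

    open Envelope R

    piecewiseLinear : PiecewiseLinearOn[0,1] 3 (λ p → κ p x y)
    piecewiseLinear = envelope-piecewiseLinear
      -- The second argument of `crossing` is the increase of the potential difference minus one: 0
      -- for consecutive lines, 1 for the outer two.
      (proj₂ (crossing d 0 (ℕₚ.m≤n+m d 2) (ℕₚ.n≤1+n (suc d))))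
      (proj₂ (crossing (suc d) 0 (ℕₚ.n≤1+n (suc d)) ℕₚ.≤-refl))
      (proj₂ (crossing d 1 (ℕₚ.m≤n+m d 2) ℕₚ.≤-refl))
      (affine d (ℕₚ.m≤n+m d 2)) (affine (suc d) (ℕₚ.n≤1+n (suc d))) (affine δ ℕₚ.≤-refl)

theorem3p2 : (em : ExcludedMiddle 0ℓ) (R : CompleteOrderedField) (G : LocallyFiniteGraph) →
    let open Curvature em R G in
    ∀ (x y : V) (δ : ℕ) → dist x y ≡ [ δ ] → 2 ℕ.≤ δ →
    ConcaveOn[0,1] (λ p → κ p x y) × PiecewiseLinearOn[0,1] 3 (λ p → κ p x y)
theorem3p2 em R G x y (suc (suc d)) dist-xy (s≤s (s≤s z≤n)) = concave , piecewiseLinear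
  where open Idleness.FarApart em R G x y d dist-xy
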